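{- (1) $\mathcal{K}^{\mathsf{TS}}(\overline{K_n})=\{k:k\ge1\}$ for $n\ge2$. (2) $\mathcal{K}^{\mathsf{TS}}(\overline{K_{1,1}})=\{k:k\ge1\}$ and $\mathcal{K}^{\mathsf{TS}}(\overline{K_{1,n}})=\{1,n-1\}$ for $n\ge2$. (3) For $2\le m\le n$: $\mathcal{K}^{\mathsf{TS}}(\overline{K_{m,n}})=\{1,n-1\}$ if $m=n$, and $=\{1\}$ if $m<n$. (4) $\mathcal{K}^{\mathsf{TS}}(\overline{B_1})=\{k:k\ge1\}$ and $\mathcal{K}^{\mathsf{TS}}(\overline{B_p})=\{1,p-1\}$ for $p\ge2$. (5) $\mathcal{K}^{\mathsf{TS}}(\overline{P_n})=\{1\}$ for $n\ge3$. (6) $\mathcal{K}^{\mathsf{TS}}(\overline{C_n})=\{1\}$ for $n\ge4$. (7) $\mathcal{K}^{\mathsf{TS}}(\overline{F_1})=\{k:k\ge1\}$, $\mathcal{K}^{\mathsf{TS}}(\overline{F_2})=\{1\}$, $\mathcal{K}^{\mathsf{TS}}(\overline{F_3})=\{1,2\}$, and $\mathcal{K}^{\mathsf{TS}}(\overline{F_p})=\{1\}$ for $p\ge4$.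
   Context: All graphs are finite, simple, undirected; $\overline{G}$ denotes the complement of $G$. A $k$-clique of a graph $H$ is a set of $k$ pairwise adjacent vertices. For a graph $H$ and integer $k\ge1$, the Token Sliding graph $\mathsf{TS}_k(H)$ has as vertices the $k$-cliques of $H$, and two $k$-cliques $A,B$ are adjacent iff $A\setminus B=\{u\}$, $B\setminus A=\{v\}$ for some vertices $u,v$ with $uv\in E(H)$. For a graph $G$, $\mathcal{K}^{\mathsf{TS}}(G)=\{k\ge1:\ \exists H,\ \mathsf{TS}_k(H)\cong G\}$. $K_n$, $P_n$, $C_n$ denote the complete graph, path, cycle on $n$ vertices; $K_{m,n}$ the complete bipartite graph. The book graph $B_p$ consists of $p$ triangles sharing a common edge; the friendship graph $F_p$ consists of $p$ triangles sharing a common vertex. -}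

module Defs where

open import Data.Bool.Properties using () renaming (_≟_ to _≟ᵇ_)
open import Data.Empty using (⊥)
open import Data.Fin using (Fin; toℕ)
open import Data.Fin.Properties using (any?) renaming (_≟_ to _≟ᶠ_)
open import Data.Fin.Subset using (Subset; _∈_; _─_; ⁅_⁆; ∣_∣)
open import Data.Fin.Subset.Properties using (x∈⁅x⁆; x∈⁅y⁆⇒x≡y)
open import Data.Nat using (ℕ; suc; _≤_)
import Data.Nat.Properties as ℕ
open import Data.Product using (Σ-syntax; ∃₂; ∃-syntax; _×_; _,_)
import Data.Product.Properties as Product
open import Data.Refinement using (Refinement; value) renaming (_≟_ to ≟-refinement)
open import Data.Sum using (_⊎_; inj₁; inj₂)
import Data.Sum as Sum
import Data.Sum.Properties as Sum
open import Data.Unit using (⊤; tt)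
import Data.Unit.Properties as Unit
import Data.Vec.Properties as Vec
open import Function using (_∘_)
open import Function.Bundles using (_↔_; _⇔_; Inverse)
open import Relation.Binary.Definitions using (Symmetric; Decidable; DecidableEquality)
open import Relation.Binary.PropositionalEquality
  using (_≡_; _≢_; refl; sym; trans; subst)
open import Relation.Nullary using (¬_; yes; no)
open import Relation.Nullary.Decidable using (¬?; _×-dec_; _⊎-dec_)
open import Relation.Unary using (Pred)
open import Level using (0ℓ) renaming (suc to lsuc)

-- Simple undirected graphs on a vertex type V.  The two decidability fields
-- hold of every finite graph classically; finiteness itself comes from the
-- choice of V, which is Fin n or built from such types throughout.
record Graph (V : Set) : Set₁ where
  field
    Adj    : V → V → Set
    symm   : Symmetric Adj
    irrefl : ∀ {v} → ¬ Adj v v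
    _≟_    : DecidableEquality V
    adj?   : Decidable Adj

open Graph public using (Adj)

infix 4 _≅_
_≅_ : {V W : Set} → Graph V → Graph W → Set
_≅_ {V} {W} G H =
  Σ[ f ∈ V ↔ W ] (∀ u v → Adj G u v ⇔ Adj H (Inverse.to f u) (Inverse.to f v))

complement : {V : Set} → Graph V → Graph V
complement G = record
  { Adj    = λ u v → u ≢ v × ¬ Adj G u v
  ; symm   = λ (u≢v , ¬uv) → u≢v ∘ sym , ¬uv ∘ symm
  ; irrefl = λ (v≢v , _) → v≢v refl
  ; _≟_    = _≟_
  ; adj?   = λ u v → ¬? (u ≟ v) ×-dec ¬? (adj? u v)
  } where open Graph G hiding (Adj)

------------------------------------------------------------------------
-- Cliques and Token Sliding graphs

IsClique : {N : ℕ} → Graph (Fin N) → ℕ → Subset N → Set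
IsClique H k S = ∣ S ∣ ≡ k × (∀ u v → u ∈ S → v ∈ S → u ≢ v → Adj H u v)

-- The refinement type makes the clique proof irrelevant, so that two
-- cliques are equal (_≡_) exactly when they have the same elements.
Clique : {N : ℕ} → Graph (Fin N) → ℕ → Set
Clique {N} H k = Refinement (Subset N) (IsClique H k)

TSAdj : {N : ℕ} → Graph (Fin N) → Subset N → Subset N → Set
TSAdj H A B = ∃₂ λ u v → A ─ B ≡ ⁅ u ⁆ × B ─ A ≡ ⁅ v ⁆ × Adj H u v

TS : {N : ℕ} (k : ℕ) (H : Graph (Fin N)) → Graph (Clique H k)
TS {N} k H = record
  { Adj    = λ A B → TSAdj H (value A) (value B)
  ; symm   = λ (u , v , A─B , B─A , uv) → v , u , B─A , A─B , symm uv
  ; irrefl = λ (u , v , A─A≡u , A─A≡v , uv) → irrefl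
      (subst (λ w → Adj H w v)
        (x∈⁅y⁆⇒x≡y v (subst (u ∈_) (trans (sym A─A≡u) A─A≡v) (x∈⁅x⁆ u))) uv)
  ; _≟_    = ≟-refinement _≟ˢ_
  ; adj?   = λ A B → any? λ u → any? λ v →
      ((value A ─ value B) ≟ˢ ⁅ u ⁆) ×-dec ((value B ─ value A) ≟ˢ ⁅ v ⁆) ×-dec adj? u v
  }
  where
  open Graph H hiding (Adj)
  _≟ˢ_ : DecidableEquality (Subset N)
  _≟ˢ_ = Vec.≡-dec _≟ᵇ_

-- H ranges over graphs on Fin N for all N: up to isomorphism, all finite graphs.
𝒦ᵀˢ : {V : Set} → Graph V → Pred ℕ (lsuc 0ℓ)
𝒦ᵀˢ G k = 1 ≤ k × (∃[ N ] Σ[ H ∈ Graph (Fin N) ] TS k H ≅ G)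

------------------------------------------------------------------------
-- Graph families

Complete : (n : ℕ) → Graph (Fin n)
Complete n = record
  { Adj    = _≢_
  ; symm   = λ u≢v → u≢v ∘ sym
  ; irrefl = λ v≢v → v≢v refl
  ; _≟_    = _≟ᶠ_
  ; adj?   = λ u v → ¬? (u ≟ᶠ v)
  }

CompleteBipartite : (m n : ℕ) → Graph (Fin m ⊎ Fin n)
CompleteBipartite m n = record
  { Adj    = E
  ; symm   = λ {u} {v} → E-sym u v
  ; irrefl = λ {v} → E-irrefl v
  ; _≟_    = Sum.≡-dec _≟ᶠ_ _≟ᶠ_
  ; adj?   = E?
  }
  where
  E : Fin m ⊎ Fin n → Fin m ⊎ Fin n → Set
  E (inj₁ _) (inj₁ _) = ⊥
  E (inj₁ _) (inj₂ _) = ⊤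
  E (inj₂ _) (inj₁ _) = ⊤
  E (inj₂ _) (inj₂ _) = ⊥

  E-sym : ∀ u v → E u v → E v u
  E-sym (inj₁ _) (inj₂ _) _ = tt
  E-sym (inj₂ _) (inj₁ _) _ = tt

  E-irrefl : ∀ v → ¬ E v v
  E-irrefl (inj₁ _) ()
  E-irrefl (inj₂ _) ()

  E? : Decidable E
  E? (inj₁ _) (inj₁ _) = no λ ()
  E? (inj₁ _) (inj₂ _) = yes tt
  E? (inj₂ _) (inj₁ _) = yes tt
  E? (inj₂ _) (inj₂ _) = no λ ()

Path : (n : ℕ) → Graph (Fin n)
Path n = record
  { Adj    = λ i j → suc (toℕ i) ≡ toℕ j ⊎ suc (toℕ j) ≡ toℕ i
  ; symm   = Sum.swap
  ; irrefl = λ { (inj₁ e) → ℕ.1+n≢n e ; (inj₂ e) → ℕ.1+n≢n e }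
  ; _≟_    = _≟ᶠ_
  ; adj?   = λ i j → (suc (toℕ i) ℕ.≟ toℕ j) ⊎-dec (suc (toℕ j) ℕ.≟ toℕ i)
  }

-- Next i j: j is the cyclic successor of i in 0, 1, …, n - 1.
Next : {n : ℕ} → Fin n → Fin n → Set
Next {n} i j = suc (toℕ i) ≡ toℕ j ⊎ (suc (toℕ i) ≡ n × toℕ j ≡ 0)

-- The condition i ≢ j only matters for n = 1; this is the usual cycle for n ≥ 3.
Cycle : (n : ℕ) → Graph (Fin n)
Cycle n = record
  { Adj    = λ i j → i ≢ j × (Next i j ⊎ Next j i)
  ; symm   = λ (i≢j , e) → i≢j ∘ sym , Sum.swap e
  ; irrefl = λ (i≢i , _) → i≢i refl
  ; _≟_    = _≟ᶠ_
  ; adj?   = λ i j → ¬? (i ≟ᶠ j) ×-dec (next? i j ⊎-dec next? j i)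
  }
  where
  next? : Decidable (Next {n})
  next? i j = (suc (toℕ i) ℕ.≟ toℕ j) ⊎-dec ((suc (toℕ i) ℕ.≟ n) ×-dec (toℕ j ℕ.≟ 0))

-- inj₁ : the two ends of the common edge (the spine);
-- inj₂ : the third vertices of the p triangles.
Book : (p : ℕ) → Graph (Fin 2 ⊎ Fin p)
Book p = record
  { Adj    = E
  ; symm   = λ {u} {v} → E-sym u v
  ; irrefl = λ {v} → E-irrefl v
  ; _≟_    = Sum.≡-dec _≟ᶠ_ _≟ᶠ_
  ; adj?   = E?
  }
  where
  E : Fin 2 ⊎ Fin p → Fin 2 ⊎ Fin p → Set
  E (inj₁ a) (inj₁ b) = a ≢ b
  E (inj₁ _) (inj₂ _) = ⊤
  E (inj₂ _) (inj₁ _) = ⊤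
  E (inj₂ _) (inj₂ _) = ⊥

  E-sym : ∀ u v → E u v → E v u
  E-sym (inj₁ _) (inj₁ _) a≢b = a≢b ∘ sym
  E-sym (inj₁ _) (inj₂ _) _   = tt
  E-sym (inj₂ _) (inj₁ _) _   = tt

  E-irrefl : ∀ v → ¬ E v v
  E-irrefl (inj₁ _) a≢a = a≢a refl
  E-irrefl (inj₂ _) ()

  E? : Decidable E
  E? (inj₁ a) (inj₁ b) = ¬? (a ≟ᶠ b)
  E? (inj₁ _) (inj₂ _) = yes tt
  E? (inj₂ _) (inj₁ _) = yes tt
  E? (inj₂ _) (inj₂ _) = no λ ()

-- inj₁ : the common vertex (the hub);
-- inj₂ (i , a) with a = 0, 1 : the other two vertices of the i-th triangle.
Friendship : (p : ℕ) → Graph (⊤ ⊎ (Fin p × Fin 2))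
Friendship p = record
  { Adj    = E
  ; symm   = λ {u} {v} → E-sym u v
  ; irrefl = λ {v} → E-irrefl v
  ; _≟_    = Sum.≡-dec Unit._≟_ (Product.≡-dec _≟ᶠ_ _≟ᶠ_)
  ; adj?   = E?
  }
  where
  E : ⊤ ⊎ (Fin p × Fin 2) → ⊤ ⊎ (Fin p × Fin 2) → Set
  E (inj₁ _)       (inj₁ _)       = ⊥
  E (inj₁ _)       (inj₂ _)       = ⊤
  E (inj₂ _)       (inj₁ _)       = ⊤
  E (inj₂ (i , a)) (inj₂ (j , b)) = i ≡ j × a ≢ b

  E-sym : ∀ u v → E u v → E v u
  E-sym (inj₁ _) (inj₂ _) _           = tt
  E-sym (inj₂ _) (inj₁ _) _           = tt
  E-sym (inj₂ _) (inj₂ _) (i≡j , a≢b) = sym i≡j , a≢b ∘ sym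

  E-irrefl : ∀ v → ¬ E v v
  E-irrefl (inj₁ _) ()
  E-irrefl (inj₂ _) (_ , a≢a) = a≢a refl

  E? : Decidable E
  E? (inj₁ _)       (inj₁ _)       = no λ ()
  E? (inj₁ _)       (inj₂ _)       = yes tt
  E? (inj₂ _)       (inj₁ _)       = yes tt
  E? (inj₂ (i , a)) (inj₂ (j , b)) = (i ≟ᶠ j) ×-dec ¬? (a ≟ᶠ b)

{-# OPTIONS --safe #-}

-- Let A be a vertex of TS_k(H) and W the set of common neighbours of A in H. The neighbours of A
-- are the cliques A - u + v with u ∈ A and v ∈ W, and they induce the Cartesian product of K_k and
-- H[W]. In such a product (i , w) and (j , w′) are never adjacent when i ≠ j and w ≠ w′, so
-- for k ≥ 2 a graph of the form TS_k(H) is very restricted around each vertex: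
--   * every edge lies in a triangle;
--   * a neighbourhood that is a clique has exactly k vertices;
--   * if y has a single non-neighbour z inside a neighbourhood, then k = 2, the neighbourhood has at
--     most four vertices, and z has no non-neighbour there other than y.
-- Conversely TS_k turns disjoint unions into disjoint unions, K_k into K_1, K_(k+1) into itself and,
-- for k = 2, K_4 into the octahedron.

module Submission where

open import Defs
open import Data.Bool using (true; false)
open import Data.Bool.Properties using () renaming (_≟_ to _≟ᵇ_)
open import Data.Empty using () renaming (⊥ to Empty)
open import Data.Fin using (Fin; zero; suc; _↑ˡ_; _↑ʳ_; splitAt; cast; inject≤)
open import Data.Fin.Patterns using (0F; 1F; 2F; 3F; 4F)
open import Data.Fin.Properties using (any?; all?; ¬Fin0; injective⇒≤; cantor-schröder-bernstein;
  +↔⊎; *↔×; 1↔⊤; ↑ˡ-injective; ↑ʳ-injective; splitAt-↑ˡ; splitAt-↑ʳ; splitAt⁻¹-↑ˡ; splitAt⁻¹-↑ʳ;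
  cast-involutive) renaming (_≟_ to _≟ᶠ_; suc-injective to Fin-suc-injective)
open import Data.Fin.Subset using (Subset; inside; outside; _∈_; _∉_; _⊆_; _─_; ⁅_⁆; ∣_∣; ⊥; ⊤; ∁)
open import Data.Fin.Subset.Properties using (_∈?_; nonempty?; Empty-unique; ∉⊥; ∈⊤; ⊆-antisym;
  x∈⁅x⁆; x∈⁅y⁆⇒x≡y; ∣⁅x⁆∣≡1; ∣⊤∣≡n; ∣⊥∣≡0; ∣p∣≡n⇒p≡⊤; ∣∁p∣≡n∸∣p∣; x∈p∧x∉q⇒x∈p─q; x∈∁p⇒x∉p; x∉p⇒x∈∁p;
  p─q⊆p; x≢y⇒x∉⁅y⁆; x∉∁p⇒x∈p)
open import Data.Irrelevant using ([_])
open import Data.Nat using (ℕ; zero; suc; _+_; _*_; _≤_; _<_; _∸_; z≤n; s≤s)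
open import Data.Nat.Properties using (<⇒≢; ≤-antisym; +-identityʳ; m+n∸n≡m; suc-injective) renaming
  (_≟_ to _≟ⁿ_)
open import Data.Product using (Σ-syntax; ∃₂; ∃-syntax; _×_; _,_; proj₁; proj₂)
import Data.Product.Properties as Product
open import Data.Refinement using (Refinement; value; _,_; value-injective)
open import Data.Sum using (_⊎_; inj₁; inj₂; [_,_]′; map₂)
import Data.Sum.Properties as Sum
open import Data.Sum.Function.Propositional using (_⊎-↔_)
open import Data.Unit using (tt) renaming (⊤ to Unit)
import Data.Vec as Vec
open import Data.Vec using ([]; _∷_; _++_; here; there; _[_]≔_)
open import Data.Vec.Properties using (lookup-++ˡ; lookup-++ʳ; []=⇒lookup; lookup⇒[]=;
  lookup∘update; lookup∘update′; ≡-dec)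
open import Function using (_∘_; id)
open import Function.Bundles using (_↔_; _⇔_; mk⇔; mk↔ₛ′; Inverse; Equivalence)
open import Function.Construct.Composition using (_↔-∘_; _⇔-∘_)
open import Function.Construct.Identity using (↔-id; ⇔-id)
open import Function.Construct.Symmetry using (↔-sym)
open import Relation.Binary.PropositionalEquality using (_≡_; _≢_; refl; sym; trans; cong; subst;
  subst₂; ≢-sym)
open import Relation.Nullary using (¬_; Dec; yes; no; contradiction)
open import Relation.Nullary.Decidable using (recompute; ¬?; from-no; from-yes; map′; _×-dec_;
  _→-dec_; decidable-stable)
open import Relation.Unary using (_≐_; _∪_; ｛_｝)

private
  variable
    k m n N : ℕ
    V V′ W W′ : Set

-- Subsets and their enumeration

-- Turns a set of tokens into an indexed family, so that the tokens of a `k`-clique can serve as the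
-- factor `Fin k` of a product.
enumerate : (S : Subset n) → Fin ∣ S ∣ → Fin n
enumerate (true  ∷ S) zero    = zero
enumerate (true  ∷ S) (suc i) = suc (enumerate S i)
enumerate (false ∷ S) i       = suc (enumerate S i)

enumerate-∈ : (S : Subset n) (i : Fin ∣ S ∣) → enumerate S i ∈ S
enumerate-∈ (true  ∷ S) zero    = here
enumerate-∈ (true  ∷ S) (suc i) = there (enumerate-∈ S i)
enumerate-∈ (false ∷ S) i       = there (enumerate-∈ S i)

enumerate-injective : (S : Subset n) {i j : Fin ∣ S ∣} → enumerate S i ≡ enumerate S j → i ≡ j
enumerate-injective (true  ∷ S) {zero}  {zero}  _  = refl
enumerate-injective (true  ∷ S) {suc i} {suc j} eq = cong suc (enumerate-injective S (Fin-suc-injective eq))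
enumerate-injective (false ∷ S)                 eq = enumerate-injective S (Fin-suc-injective eq)

enumerate-surjective : {S : Subset n} {x : Fin n} → x ∈ S → ∃[ i ] enumerate S i ≡ x
enumerate-surjective here = zero , refl
enumerate-surjective {S = true ∷ S} (there x∈S) with i , eq ← enumerate-surjective x∈S = suc i , cong suc eq
enumerate-surjective {S = false ∷ S} (there x∈S) with i , eq ← enumerate-surjective x∈S = i , cong suc eq

∣p∣≡1⇒p≡⁅x⁆ : (S : Subset n) → ∣ S ∣ ≡ 1 → ∃[ x ] ⁅ x ⁆ ≡ S
-- The tail has cardinality 0, so a member of it would have an index in `Fin 0`.
∣p∣≡1⇒p≡⁅x⁆ (true ∷ S) eq = zero , cong (true ∷_) (sym (Empty-unique λ (_ , x∈S) →
  ¬Fin0 (subst Fin (suc-injective eq) (proj₁ (enumerate-surjective x∈S)))))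
∣p∣≡1⇒p≡⁅x⁆ (false ∷ S) eq with x , eq′ ← ∣p∣≡1⇒p≡⁅x⁆ S eq = suc x , cong (false ∷_) eq′

1≤∣p∣⇒Nonempty : (p : Subset n) → 1 ≤ ∣ p ∣ → ∃[ x ] x ∈ p
1≤∣p∣⇒Nonempty p 1≤∣p∣ = let i = inject≤ 0F 1≤∣p∣ in enumerate p i , enumerate-∈ p i

∣p++q∣≡∣p∣+∣q∣ : (p : Subset m) (q : Subset n) → ∣ p ++ q ∣ ≡ ∣ p ∣ + ∣ q ∣
∣p++q∣≡∣p∣+∣q∣ []          q = refl
∣p++q∣≡∣p∣+∣q∣ (true  ∷ p) q = cong suc (∣p++q∣≡∣p∣+∣q∣ p q)
∣p++q∣≡∣p∣+∣q∣ (false ∷ p) q = ∣p++q∣≡∣p∣+∣q∣ p q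

∣p[x]≔in∣ : {p : Subset n} {x : Fin n} → x ∉ p → ∣ p [ x ]≔ inside ∣ ≡ suc ∣ p ∣
∣p[x]≔in∣ {p = true  ∷ p} {zero}  x∉p = contradiction here x∉p
∣p[x]≔in∣ {p = false ∷ p} {zero}  x∉p = refl
∣p[x]≔in∣ {p = true  ∷ p} {suc x} x∉p = cong suc (∣p[x]≔in∣ (x∉p ∘ there))
∣p[x]≔in∣ {p = false ∷ p} {suc x} x∉p = ∣p[x]≔in∣ (x∉p ∘ there)

∣p[x]≔out∣ : {p : Subset n} {x : Fin n} → x ∈ p → suc ∣ p [ x ]≔ outside ∣ ≡ ∣ p ∣
∣p[x]≔out∣ here = refl
∣p[x]≔out∣ {p = true  ∷ p} (there x∈p) = cong suc (∣p[x]≔out∣ x∈p)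
∣p[x]≔out∣ {p = false ∷ p} (there x∈p) = ∣p[x]≔out∣ x∈p

x∈p─q⇒x∉q : (p q : Subset n) {x : Fin n} → x ∈ p ─ q → x ∉ q
x∈p─q⇒x∉q (s ∷ p) (true  ∷ q) (there x∈) (there x∈q) = x∈p─q⇒x∉q p q x∈ x∈q
x∈p─q⇒x∉q (s ∷ p) (false ∷ q) (there x∈) (there x∈q) = x∈p─q⇒x∉q p q x∈ x∈q

-- Removal comes before insertion, so `v` belongs to the result even if `u ≡ v`; `∈-exchange-new`
-- therefore holds unconditionally.
exchange : Subset n → Fin n → Fin n → Subset n
exchange A u v = (A [ u ]≔ outside) [ v ]≔ inside

module _ {A : Subset n} {u v : Fin n} where

  ∈-exchange-new : v ∈ exchange A u v
  ∈-exchange-new = lookup⇒[]= v _ (lookup∘update v (A [ u ]≔ outside) inside)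

  ∈-exchange-old : ∀ {x} → x ∈ A → x ≢ u → x ∈ exchange A u v
  ∈-exchange-old {x} x∈A x≢u with x ≟ᶠ v
  ... | yes refl = ∈-exchange-new
  ... | no x≢v = lookup⇒[]= x _ (trans (lookup∘update′ x≢v (A [ u ]≔ outside) inside)
    (trans (lookup∘update′ x≢u A outside) ([]=⇒lookup x∈A)))

  ∈-exchange⁻ : ∀ {x} → x ∈ exchange A u v → x ≡ v ⊎ (x ∈ A × x ≢ u)
  ∈-exchange⁻ {x} x∈ with x ≟ᶠ v
  ... | yes x≡v = inj₁ x≡v
  ... | no x≢v with x ≟ᶠ u | trans (sym (lookup∘update′ x≢v (A [ u ]≔ outside) inside)) ([]=⇒lookup x∈)
  ...   | yes refl | eq = contradiction (trans (sym (lookup∘update x A outside)) eq) λ ()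
  ...   | no x≢u   | eq = inj₂ (lookup⇒[]= x A (trans (sym (lookup∘update′ x≢u A outside)) eq) , x≢u)

  ∣exchange∣ : u ∈ A → v ∉ A → ∣ exchange A u v ∣ ≡ ∣ A ∣
  ∣exchange∣ u∈A v∉A = trans (∣p[x]≔in∣ v∉A-u) (∣p[x]≔out∣ u∈A)
    where
    v∉A-u : v ∉ A [ u ]≔ outside
    v∉A-u v∈ with v ≟ᶠ u
    ... | yes refl = v∉A u∈A
    ... | no v≢u = v∉A (lookup⇒[]= v A (trans (sym (lookup∘update′ v≢u A outside)) ([]=⇒lookup v∈)))

-- Sliding a token

-- Elementwise form of `TSAdj`: the two equations between differences and singletons become
-- membership facts that later arguments can apply directly.
record Slide (H : Graph (Fin N)) (A B : Subset N) : Set where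
  field
    from to : Fin N
    from∈   : from ∈ A
    from∉   : from ∉ B
    to∈     : to ∈ B
    to∉     : to ∉ A
    A∖B     : ∀ {x} → x ∈ A → x ∉ B → x ≡ from
    B∖A     : ∀ {x} → x ∈ B → x ∉ A → x ≡ to
    edge    : Adj H from to

open Slide

≡⁅⁆ : {p : Subset n} {x : Fin n} → x ∈ p → (∀ {y} → y ∈ p → y ≡ x) → p ≡ ⁅ x ⁆
≡⁅⁆ {x = x} x∈p uniq = ⊆-antisym
  (λ y∈p → subst (_∈ ⁅ x ⁆) (sym (uniq y∈p)) (x∈⁅x⁆ x))
  (λ y∈⁅x⁆ → subst (_∈ _) (sym (x∈⁅y⁆⇒x≡y x y∈⁅x⁆)) x∈p)

module _ {H : Graph (Fin N)} {A B : Subset N} where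

  slide⇒TSAdj : Slide H A B → TSAdj H A B
  slide⇒TSAdj s = from s , to s
    , ≡⁅⁆ (x∈p∧x∉q⇒x∈p─q (from∈ s) (from∉ s)) (λ y∈ → A∖B s (p─q⊆p A B y∈) (x∈p─q⇒x∉q A B y∈))
    , ≡⁅⁆ (x∈p∧x∉q⇒x∈p─q (to∈ s) (to∉ s)) (λ y∈ → B∖A s (p─q⊆p B A y∈) (x∈p─q⇒x∉q B A y∈))
    , edge s

  TSAdj⇒slide : TSAdj H A B → Slide H A B
  TSAdj⇒slide (u , v , A─B , B─A , uv) = record
    { from  = u
    ; to    = v
    ; from∈ = p─q⊆p A B u∈
    ; from∉ = x∈p─q⇒x∉q A B u∈
    ; to∈   = p─q⊆p B A v∈
    ; to∉   = x∈p─q⇒x∉q B A v∈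
    ; A∖B   = λ x∈A x∉B → x∈⁅y⁆⇒x≡y u (subst (_ ∈_) A─B (x∈p∧x∉q⇒x∈p─q x∈A x∉B))
    ; B∖A   = λ x∈B x∉A → x∈⁅y⁆⇒x≡y v (subst (_ ∈_) B─A (x∈p∧x∉q⇒x∈p─q x∈B x∉A))
    ; edge  = uv
    }
    where
    u∈ : u ∈ A ─ B
    u∈ = subst (u ∈_) (sym A─B) (x∈⁅x⁆ u)
    v∈ : v ∈ B ─ A
    v∈ = subst (v ∈_) (sym B─A) (x∈⁅x⁆ v)

-- The clique proof stored in a `Clique` is irrelevant. Equality of naturals and adjacency in `H`
-- are decidable, so a relevant proof can be recomputed.
isClique : (H : Graph (Fin N)) (A : Clique H k) → IsClique H k (value A)
isClique H (A , [ clique ])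
  = recompute (_ ≟ⁿ _) (proj₁ clique)
  , λ u v u∈A v∈A u≢v → recompute (Graph.adj? H u v) (proj₂ clique u v u∈A v∈A u≢v)

-- Isomorphisms

≅-trans : {G : Graph V} {G′ : Graph V′} {G″ : Graph W} → G ≅ G′ → G′ ≅ G″ → G ≅ G″
≅-trans (f , f-adj) (g , g-adj) = g ↔-∘ f , λ u v → g-adj _ _ ⇔-∘ f-adj u v

≅-sym : {G : Graph V} {G′ : Graph V′} → G ≅ G′ → G′ ≅ G
≅-sym {G = G} {G′} (f , f-adj) = ↔-sym f , λ u v →
  mk⇔ (λ a → Equivalence.from (f-adj _ _) (subst₂ (Adj G′) (sym (Inverse.strictlyInverseˡ f u)) (sym (Inverse.strictlyInverseˡ f v)) a))
      (λ a → subst₂ (Adj G′) (Inverse.strictlyInverseˡ f u) (Inverse.strictlyInverseˡ f v) (Equivalence.to (f-adj _ _) a))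

≅-fromAdj : {G G′ : Graph V} → (∀ u v → Adj G u v ⇔ Adj G′ u v) → G ≅ G′
≅-fromAdj adj⇔ = ↔-id _ , adj⇔

-- Disjoint unions and relabelling

infixr 5 _⊔ᴳ_
_⊔ᴳ_ : Graph V → Graph W → Graph (V ⊎ W)
_⊔ᴳ_ {V} {W} G G′ = record
  { Adj    = E
  ; symm   = λ {u} {v} → E-sym u v
  ; irrefl = λ {v} → E-irrefl v
  ; _≟_    = Sum.≡-dec (Graph._≟_ G) (Graph._≟_ G′)
  ; adj?   = E?
  }
  where
  E : V ⊎ W → V ⊎ W → Set
  E (inj₁ u) (inj₁ v) = Adj G u v
  E (inj₁ _) (inj₂ _) = Empty
  E (inj₂ _) (inj₁ _) = Empty
  E (inj₂ u) (inj₂ v) = Adj G′ u v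

  E-sym : ∀ u v → E u v → E v u
  E-sym (inj₁ _) (inj₁ _) a = Graph.symm G a
  E-sym (inj₂ _) (inj₂ _) a = Graph.symm G′ a

  E-irrefl : ∀ v → ¬ E v v
  E-irrefl (inj₁ _) = Graph.irrefl G
  E-irrefl (inj₂ _) = Graph.irrefl G′

  E? : ∀ u v → Dec (E u v)
  E? (inj₁ u) (inj₁ v) = Graph.adj? G u v
  E? (inj₁ _) (inj₂ _) = no λ ()
  E? (inj₂ _) (inj₁ _) = no λ ()
  E? (inj₂ u) (inj₂ v) = Graph.adj? G′ u v

⊔ᴳ-cong : {G : Graph V} {G′ : Graph V′} {K : Graph W} {K′ : Graph W′} → G ≅ G′ → K ≅ K′ → G ⊔ᴳ K ≅ G′ ⊔ᴳ K′
⊔ᴳ-cong (f , f-adj) (g , g-adj) = (f ⊎-↔ g) , λ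
  { (inj₁ u) (inj₁ v) → f-adj u v
  ; (inj₁ u) (inj₂ v) → ⇔-id _
  ; (inj₂ u) (inj₁ v) → ⇔-id _
  ; (inj₂ u) (inj₂ v) → g-adj u v
  }

-- Host graphs must live on some `Fin N`, whereas unions and the families of the theorem live on
-- sums and products; this carries them over.
relabel : V ↔ W → Graph W → Graph V
relabel f G = record
  { Adj    = λ u v → Adj G (to′ u) (to′ v)
  ; symm   = Graph.symm G
  ; irrefl = Graph.irrefl G
  ; _≟_    = λ u v → map′ (λ eq → trans (sym (Inverse.strictlyInverseʳ f u)) (trans (cong (Inverse.from f) eq) (Inverse.strictlyInverseʳ f v)))
                           (cong to′) (Graph._≟_ G (to′ u) (to′ v))
  ; adj?   = λ u v → Graph.adj? G (to′ u) (to′ v)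
  }
  where to′ = Inverse.to f

relabel-≅ : (f : V ↔ W) (G : Graph W) → relabel f G ≅ G
relabel-≅ f G = f , λ _ _ → ⇔-id _

-- Lets an isomorphism be given by naming the cliques as plain subsets. The inverse map comes from
-- surjectivity, and cliques with the same underlying subset are equal because their proofs are
-- irrelevant.
TS≅ : {H : Graph (Fin N)} {G : Graph V} (f : V → Subset N) →
      (∀ v → IsClique H k (f v)) →
      (∀ {u v} → f u ≡ f v → u ≡ v) →
      (∀ S → IsClique H k S → ∃[ v ] f v ≡ S) →
      (∀ u v → Slide H (f u) (f v) ⇔ Adj G u v) →
      TS k H ≅ G
TS≅ {H = H} {G} f f-clique f-injective f-surjective f-adj =
  mk↔ₛ′ (proj₁ ∘ vertex) (λ v → f v , [ f-clique v ])
    (λ v → f-injective (proj₂ (vertex (f v , [ f-clique v ]))))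
    (λ A → value-injective (proj₂ (vertex A)))
  , λ A B → f-adj _ _ ⇔-∘ mk⇔
      (TSAdj⇒slide ∘ subst₂ (TSAdj H) (sym (proj₂ (vertex A))) (sym (proj₂ (vertex B))))
      (subst₂ (TSAdj H) (proj₂ (vertex A)) (proj₂ (vertex B)) ∘ slide⇒TSAdj)
  where
  vertex : (A : Clique H _) → ∃[ v ] f v ≡ value A
  vertex A = f-surjective (value A) (isClique H A)

-- Realizations

Realizable : ℕ → Graph V → Set₁
Realizable k G = ∃[ N ] Σ[ H ∈ Graph (Fin N) ] TS k H ≅ G

realizable-≅ : {G : Graph V} {G′ : Graph V′} → G ≅ G′ → Realizable k G → Realizable k G′
realizable-≅ {G = G} {G′} e (N , H , f) = N , H , ≅-trans {G = TS _ H} {G} {G′} f e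

-- Cartesian product neighbourhoods

-- The neighbourhood of x is the Cartesian product of Complete k with a graph on W.
record ProductNeighbourhood {V : Set} (k : ℕ) (G : Graph V) (x : V) : Set₁ where
  field
    Fibre           : Set
    point           : Fin k → Fibre → V
    point-adj       : ∀ i w → Adj G x (point i w)
    point-cover     : ∀ {y} → Adj G x y → ∃₂ λ i w → y ≡ point i w
    point-injective : ∀ {i j w w′} → point i w ≡ point j w′ → i ≡ j × w ≡ w′
    row             : ∀ {i j} w → i ≢ j → Adj G (point i w) (point j w)
    column          : ∀ {i w w′} j → Adj G (point i w) (point i w′) → Adj G (point j w) (point j w′)
    diagonal        : ∀ {i j w w′} → i ≢ j → w ≢ w′ → ¬ Adj G (point i w) (point j w′)

-- A neighbour of `A` replaces one token, the index in `Fin k`, by one common neighbour of `A`, the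
-- fibre element. A row changes which token is missing, along an edge inside `A`; a column changes
-- the new vertex, along an edge between common neighbours.
TS-neighbourhood : (H : Graph (Fin N)) (A : Clique H k) → ProductNeighbourhood k (TS k H) A
TS-neighbourhood {N} {k} H A′ = record
  { Fibre           = CommonNeighbour
  ; point           = swap
  ; point-adj       = λ i w → slide⇒TSAdj (slide-out i w)
  ; point-cover     = λ {D} s → cover D (TSAdj⇒slide s)
  ; point-injective = λ {i} {j} {w} {w′} eq → swap-injective i j w w′ (cong value eq)
  ; row             = λ {i} {j} w i≢j → slide⇒TSAdj (slide-row i j w i≢j)
  ; column          = λ {i} {w} {w′} j s → slide⇒TSAdj (slide-column i j w w′ (TSAdj⇒slide s))
  ; diagonal        = λ {i} {j} {w} {w′} i≢j w≢w′ s → slide-diagonal i j w w′ i≢j w≢w′ (TSAdj⇒slide s)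
  }
  where
  open Graph H using (adj?; irrefl; symm)

  A : Subset N
  A = value A′

  ∣A∣≡k : ∣ A ∣ ≡ k
  ∣A∣≡k = proj₁ (isClique H A′)

  A-adj : ∀ u v → u ∈ A → v ∈ A → u ≢ v → Adj H u v
  A-adj = proj₂ (isClique H A′)

  -- A refinement, so that common neighbours at the same vertex of `H` are equal, as
  -- `point-injective` requires.
  CommonNeighbour : Set
  CommonNeighbour = Refinement (Fin N) λ v → ∀ u → u ∈ A → Adj H u v

  common : ∀ (w : CommonNeighbour) {u} → u ∈ A → Adj H u (value w)
  common (v , [ c ]) {u} u∈A = recompute (adj? u v) (c u u∈A)

  common∉A : ∀ w → value w ∉ A
  common∉A w w∈A = irrefl (common w w∈A)

  elem : Fin k → Fin N
  elem i = enumerate A (cast (sym ∣A∣≡k) i)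

  elem∈A : ∀ i → elem i ∈ A
  elem∈A i = enumerate-∈ A (cast (sym ∣A∣≡k) i)

  elem-injective : ∀ {i j} → elem i ≡ elem j → i ≡ j
  elem-injective {i} {j} eq = trans (sym (cast-involutive ∣A∣≡k (sym ∣A∣≡k) i))
    (trans (cong (cast ∣A∣≡k) (enumerate-injective A eq)) (cast-involutive ∣A∣≡k (sym ∣A∣≡k) j))

  elem-surjective : ∀ {u} → u ∈ A → ∃[ i ] elem i ≡ u
  elem-surjective u∈A with i , eq ← enumerate-surjective u∈A =
    cast ∣A∣≡k i , trans (cong (enumerate A) (cast-involutive (sym ∣A∣≡k) ∣A∣≡k i)) eq

  _⟦_↦_⟧ : (S : Subset N) → Fin k → CommonNeighbour → Subset N
  S ⟦ i ↦ w ⟧ = exchange S (elem i) (value w)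

  exchange-clique : ∀ i w → IsClique H k (A ⟦ i ↦ w ⟧)
  exchange-clique i w = trans (∣exchange∣ (elem∈A i) (common∉A w)) ∣A∣≡k , λ u v u∈ v∈ u≢v → adj u≢v (∈-exchange⁻ u∈) (∈-exchange⁻ v∈)
    where
    adj : ∀ {u v} → u ≢ v → u ≡ value w ⊎ (u ∈ A × u ≢ elem i) → v ≡ value w ⊎ (v ∈ A × v ≢ elem i) → Adj H u v
    adj u≢v (inj₁ refl)      (inj₁ refl)      = contradiction refl u≢v
    adj u≢v (inj₁ refl)      (inj₂ (v∈A , _)) = symm (common w v∈A)
    adj u≢v (inj₂ (u∈A , _)) (inj₁ refl)      = common w u∈A
    adj u≢v (inj₂ (u∈A , _)) (inj₂ (v∈A , _)) = A-adj _ _ u∈A v∈A u≢v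

  swap : Fin k → CommonNeighbour → Clique H k
  swap i w = A ⟦ i ↦ w ⟧ , [ exchange-clique i w ]

  elem∉ : ∀ i w → elem i ∉ A ⟦ i ↦ w ⟧
  elem∉ i w u∈ with ∈-exchange⁻ u∈
  ... | inj₁ eq        = common∉A w (subst (_∈ A) eq (elem∈A i))
  ... | inj₂ (_ , u≢u) = u≢u refl

  ∈-swap-A : ∀ {i w x} → x ∈ A ⟦ i ↦ w ⟧ → x ≢ value w → x ∈ A × x ≢ elem i
  ∈-swap-A x∈ x≢w = [ (λ eq → contradiction eq x≢w) , id ]′ (∈-exchange⁻ x∈)

  elem∈ : ∀ i j w → i ≢ j → elem j ∈ A ⟦ i ↦ w ⟧
  elem∈ i j w i≢j = ∈-exchange-old (elem∈A j) (i≢j ∘ sym ∘ elem-injective)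

  slide-out : ∀ i w → Slide H A (A ⟦ i ↦ w ⟧)
  slide-out i w = record
    { from  = elem i
    ; to    = value w
    ; from∈ = elem∈A i
    ; from∉ = elem∉ i w
    ; to∈   = ∈-exchange-new
    ; to∉   = common∉A w
    ; A∖B   = λ {x} x∈A x∉ → decidable-stable (x ≟ᶠ elem i) λ x≢u → x∉ (∈-exchange-old x∈A x≢u)
    ; B∖A   = λ {x} x∈ x∉A → decidable-stable (x ≟ᶠ value w) λ x≢w → x∉A (proj₁ (∈-swap-A {i} {w} x∈ x≢w))
    ; edge  = common w (elem∈A i)
    }

  slide-row : ∀ i j w → i ≢ j → Slide H (A ⟦ i ↦ w ⟧) (A ⟦ j ↦ w ⟧)
  slide-row i j w i≢j = record
    -- The first clique lacks `elem i` and the second lacks `elem j`, so the token on `elem j` moves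
    -- to `elem i`.
    { from  = elem j
    ; to    = elem i
    ; from∈ = elem∈ i j w i≢j
    ; from∉ = elem∉ j w
    ; to∈   = elem∈ j i w (≢-sym i≢j)
    ; to∉   = elem∉ i w
    ; A∖B   = only i j
    ; B∖A   = only j i
    ; edge  = A-adj _ _ (elem∈A j) (elem∈A i) (i≢j ∘ sym ∘ elem-injective)
    }
    where
    only : ∀ i j {x} → x ∈ A ⟦ i ↦ w ⟧ → x ∉ A ⟦ j ↦ w ⟧ → x ≡ elem j
    only i j {x} x∈ x∉ = decidable-stable (x ≟ᶠ elem j) λ x≢u → [ (λ { refl → x∉ ∈-exchange-new }) , (λ (x∈A , _) → x∉ (∈-exchange-old x∈A x≢u)) ]′ (∈-exchange⁻ x∈)

  new∉ : ∀ j w w′ → value w ≢ value w′ → value w ∉ A ⟦ j ↦ w′ ⟧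
  new∉ j w w′ w≢w′ w∈ = common∉A w (proj₁ (∈-swap-A {j} {w′} w∈ w≢w′))

  slide-column : ∀ i j w w′ → Slide H (A ⟦ i ↦ w ⟧) (A ⟦ i ↦ w′ ⟧) → Slide H (A ⟦ j ↦ w ⟧) (A ⟦ j ↦ w′ ⟧)
  slide-column i j w w′ s = record
    { from  = value w
    ; to    = value w′
    ; from∈ = ∈-exchange-new
    ; from∉ = new∉ j w w′ w≢w′
    ; to∈   = ∈-exchange-new
    ; to∉   = new∉ j w′ w (≢-sym w≢w′)
    ; A∖B   = only w w′
    ; B∖A   = only w′ w
    -- The cliques at `i` differ in `w` and `w′`, so the given slide runs from `w` to `w′`; its edge
    -- is the one needed at `j`.
    ; edge  = subst₂ (Adj H) (sym (A∖B s ∈-exchange-new (new∉ i w w′ w≢w′))) (sym (B∖A s ∈-exchange-new (new∉ i w′ w (≢-sym w≢w′)))) (edge s)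
    }
    where
    only : ∀ w w′ {x} → x ∈ A ⟦ j ↦ w ⟧ → x ∉ A ⟦ j ↦ w′ ⟧ → x ≡ value w
    only w w′ x∈ x∉ = [ id , (λ (x∈A , x≢u) → contradiction (∈-exchange-old x∈A x≢u) x∉) ]′ (∈-exchange⁻ x∈)

    w≢w′ : value w ≢ value w′
    w≢w′ eq = from∉ s (subst (λ v → from s ∈ exchange A (elem i) v) eq (from∈ s))

  -- Both `elem j` and `w` lie in the first clique and not in the second. A single slide removes one
  -- vertex only, so they would coincide, although `w` is outside `A`.
  slide-diagonal : ∀ i j w w′ → i ≢ j → w ≢ w′ → ¬ Slide H (A ⟦ i ↦ w ⟧) (A ⟦ j ↦ w′ ⟧)
  slide-diagonal i j w w′ i≢j w≢w′ s = common∉A w (subst (_∈ A) u≡w (elem∈A j))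
    where
    u≡w : elem j ≡ value w
    u≡w = trans (A∖B s (elem∈ i j w i≢j) (elem∉ j w′)) (sym (A∖B s ∈-exchange-new (new∉ j w w′ (w≢w′ ∘ value-injective))))

  swap-injective : ∀ i j w w′ → A ⟦ i ↦ w ⟧ ≡ A ⟦ j ↦ w′ ⟧ → i ≡ j × w ≡ w′
  swap-injective i j w w′ eq
    = decidable-stable (i ≟ᶠ j) (λ i≢j → elem∉ j w′ (subst (elem j ∈_) eq (elem∈ i j w i≢j)))
    , value-injective (decidable-stable (value w ≟ᶠ value w′) λ w≢w′ → new∉ j w w′ w≢w′ (subst (value w ∈_) eq ∈-exchange-new))

  cover : ∀ D → Slide H A (value D) → ∃₂ λ i w → D ≡ swap i w
  cover D s with elem-surjective (from∈ s)
  ... | i , refl = i , w , value-injective (⊆-antisym D⊆ ⊆D)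
    where
    -- The vertex that loses its token is joined to `to s` by the slide; every other vertex of `A`
    -- stays in `D`, which is a clique containing `to s`.
    c : ∀ u → u ∈ A → Adj H u (to s)
    c u u∈A with u ≟ᶠ elem i
    ... | yes refl = edge s
    ... | no u≢ = proj₂ (isClique H D) u (to s) (decidable-stable (u ∈? value D) (u≢ ∘ A∖B s u∈A)) (to∈ s) λ { refl → to∉ s u∈A }

    w : CommonNeighbour
    w = to s , [ c ]

    D⊆ : value D ⊆ A ⟦ i ↦ w ⟧
    D⊆ {x} x∈D with x ∈? A
    ... | yes x∈A = ∈-exchange-old x∈A λ { refl → from∉ s x∈D }
    ... | no x∉A with refl ← B∖A s x∈D x∉A = ∈-exchange-new

    ⊆D : A ⟦ i ↦ w ⟧ ⊆ value D
    ⊆D {x} x∈ with ∈-exchange⁻ x∈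
    ... | inj₁ refl = to∈ s
    ... | inj₂ (x∈A , x≢u) = decidable-stable (x ∈? value D) (x≢u ∘ A∖B s x∈A)

neighbourhood-≅ : {G : Graph V} {G′ : Graph V′} (e : G ≅ G′) {x : V} →
                  ProductNeighbourhood k G x → ProductNeighbourhood k G′ (Inverse.to (proj₁ e) x)
neighbourhood-≅ {G = G} {G′} (f , f-adj) P = record
  { Fibre           = Fibre
  ; point           = λ i w → φ (point i w)
  ; point-adj       = λ i w → adj⁺ (point-adj i w)
  ; point-cover     = λ a → let i , w , eq = point-cover (adj⁻ (subst (Adj G′ _) (sym (Inverse.strictlyInverseˡ f _)) a))
                            in i , w , trans (sym (Inverse.strictlyInverseˡ f _)) (cong φ eq)
  ; point-injective = λ eq → point-injective (trans (sym (Inverse.strictlyInverseʳ f _)) (trans (cong (Inverse.from f) eq) (Inverse.strictlyInverseʳ f _)))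
  ; row             = λ w i≢j → adj⁺ (row w i≢j)
  ; column          = λ j a → adj⁺ (column j (adj⁻ a))
  ; diagonal        = λ i≢j w≢w′ a → diagonal i≢j w≢w′ (adj⁻ a)
  }
  where
  open ProductNeighbourhood P
  φ = Inverse.to f

  adj⁺ : ∀ {u v} → Adj G u v → Adj G′ (φ u) (φ v)
  adj⁺ = Equivalence.to (f-adj _ _)

  adj⁻ : ∀ {u v} → Adj G′ (φ u) (φ v) → Adj G u v
  adj⁻ = Equivalence.from (f-adj _ _)

realizable-neighbourhood : {G : Graph V} → Realizable k G → ∀ x → ProductNeighbourhood k G x
realizable-neighbourhood {k = k} {G} (N , H , e) x = subst (ProductNeighbourhood k G) (Inverse.strictlyInverseˡ (proj₁ e) x)
  (neighbourhood-≅ {G = TS k H} e (TS-neighbourhood H (Inverse.from (proj₁ e) x)))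

-- Consequences of the product structure for k at least 2

other : 2 ≤ k → (i : Fin k) → ∃[ j ] i ≢ j
other (s≤s (s≤s _)) zero    = 1F , λ ()
other (s≤s (s≤s _)) (suc _) = 0F , λ ()

module _ {G : Graph V} {x : V} (P : ProductNeighbourhood k G x) (2≤k : 2 ≤ k) where

  open ProductNeighbourhood P

  open Graph G using (symm; irrefl; adj?) renaming (_≟_ to _≟ⱽ_)

  -- If `y` is the point `(i , w)`, any `(j , w)` with `j` different from `i` lies in the same row
  -- and completes the triangle.
  edge-in-triangle : ∀ {y} → Adj G x y → ∃[ z ] Adj G x z × Adj G y z
  edge-in-triangle {y} xy =
    let i , w , y≡p = point-cover xy
        j , i≢j = other 2≤k i
    in point j w , point-adj j w , subst (λ v → Adj G v (point j w)) (sym y≡p) (row w i≢j)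

  -- Two fibre elements would produce a non-adjacent diagonal pair, so a neighbourhood that is a
  -- clique consists of the single row over `w₀`. Its size is compared with `k` by injections in
  -- both directions.
  clique-neighbourhood-size : ∀ {d} (ι : Fin d → V) → (∀ {i j} → ι i ≡ ι j → i ≡ j) → (∀ i → Adj G x (ι i)) →
                              (∀ {y} → Adj G x y → ∃[ i ] y ≡ ι i) → (∀ i j → i ≢ j → Adj G (ι i) (ι j)) → 1 ≤ d → d ≡ k
  clique-neighbourhood-size {d = suc d} ι ι-injective ι-adj ι-cover ι-clique _ =
    cantor-schröder-bernstein {f = index} {g = slot}
      (λ {i} {j} eq → ι-injective (trans (index-point i) (trans (cong (λ l → point l w₀) eq) (sym (index-point j)))))
      (λ {i} {j} eq → proj₁ (point-injective (trans (slot-ι i) (trans (cong ι eq) (sym (slot-ι j))))))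
    where
    w₀ : Fibre
    w₀ = proj₁ (proj₂ (point-cover (ι-adj zero)))

    adj-nbrs : ∀ {y z} → Adj G x y → Adj G x z → y ≢ z → Adj G y z
    adj-nbrs xy xz y≢z with i , refl ← ι-cover xy | j , refl ← ι-cover xz = ι-clique i j (y≢z ∘ cong ι)

    index : Fin (suc d) → Fin k
    index i = proj₁ (point-cover (ι-adj i))

    index-point : ∀ i → ι i ≡ point (index i) w₀
    -- Equality is decidable on `V` but not assumed so on `Fibre`; the argument by contradiction
    -- therefore compares points rather than fibre elements.
    index-point i with l , w , eq ← point-cover (ι-adj i) = trans eq (decidable-stable (point l w ≟ⱽ point l w₀) λ p≢p₀ →
      let j , l≢j = other 2≤k l
      in diagonal l≢j (p≢p₀ ∘ cong (point l)) (adj-nbrs (point-adj l w) (point-adj j w₀) (l≢j ∘ proj₁ ∘ point-injective)))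

    slot : Fin k → Fin (suc d)
    slot l = proj₁ (ι-cover (point-adj l w₀))

    slot-ι : ∀ l → point l w₀ ≡ ι (slot l)
    slot-ι l = proj₂ (ι-cover (point-adj l w₀))

  -- In Complete k □ W, a vertex (i , w) has (k - 1)(∣W∣ - 1) non-neighbours (j , w′) off its row and column.
  unique-nonneighbour : ∀ {y z} → Adj G x y → Adj G x z → y ≢ z → ¬ Adj G y z →
                        (∀ {v} → Adj G x v → v ≢ y → ¬ Adj G y v → v ≡ z) →
                        k ≡ 2 × ∃₂ λ p q → (Adj G x p × Adj G z p) × (Adj G x q × Adj G z q) ×
                          (∀ {v} → Adj G x v → v ≢ y → v ≢ z → v ≡ p ⊎ v ≡ q)
  unique-nonneighbour {y} {z} xy xz y≢z y≁z unique
    with i , w , refl ← point-cover xy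
       | j , w′ , refl ← point-cover xz
    = ≤-antisym (injective⇒≤ two-injective) 2≤k
    -- The indices are only `i` and `j`, the fibre elements only `w` and `w′`. In this two by two
    -- grid `y` and `z` are opposite corners, and the witnesses are the other two.
    , point i w′ , point j w
    , (point-adj i w′ , row w′ (≢-sym i≢j))
    , (point-adj j w , symm (column j column-adj))
    , λ xv v≢y v≢z → cover (point-cover xv) v≢y v≢z
    where
    off-diagonal : ∀ l v → i ≢ l → point i w ≢ point i v → point l v ≡ point j w′
    off-diagonal l v i≢l w≢v = unique (point-adj l v) (≢-sym i≢l ∘ proj₁ ∘ point-injective) (diagonal i≢l (w≢v ∘ cong (point i)))

    -- If `z` shared the index of `y`, then `point l w′` for another index `l` would be a second
    -- non-neighbour of `y`.
    i≢j : i ≢ j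
    i≢j refl = let l , i≢l = other 2≤k i in i≢l (sym (proj₁ (point-injective (off-diagonal l w′ i≢l y≢z))))

    w≢w′ : point i w ≢ point i w′
    w≢w′ eq = y≁z (subst (λ v → Adj G v (point j w′)) (sym eq) (row w′ i≢j))

    rows : ∀ l → l ≢ i → l ≡ j
    rows l l≢i = proj₁ (point-injective (off-diagonal l w′ (≢-sym l≢i) w≢w′))

    columns : ∀ v → point i w ≢ point i v → v ≡ w′
    columns v w≢v = proj₂ (point-injective (off-diagonal j v i≢j w≢v))

    -- Otherwise `point i w′` would be a non-neighbour of `y`, hence equal to `z`, which has index
    -- `j`.
    column-adj : Adj G (point i w) (point i w′)
    column-adj = decidable-stable (adj? (point i w) (point i w′)) λ ≁ →
      i≢j (proj₁ (point-injective (unique (point-adj i w′) (≢-sym w≢w′) ≁)))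

    two : Fin k → Fin 2
    two l with l ≟ᶠ i
    ... | yes _ = 0F
    ... | no _  = 1F

    two-injective : ∀ {a b} → two a ≡ two b → a ≡ b
    two-injective {a} {b} eq with a ≟ᶠ i | b ≟ᶠ i
    two-injective {a} {b} eq | yes refl | yes refl = refl
    two-injective {a} {b} eq | no a≢i   | no b≢i   = trans (rows a a≢i) (sym (rows b b≢i))
    two-injective {a} {b} () | yes _    | no _
    two-injective {a} {b} () | no _     | yes _

    cover : ∀ {v} → (∃₂ λ l u → v ≡ point l u) → v ≢ point i w → v ≢ point j w′ → v ≡ point i w′ ⊎ v ≡ point j w
    cover (l , u , refl) v≢y v≢z with l ≟ᶠ i
    ... | yes refl = inj₁ (cong (point i) (columns u (≢-sym v≢y)))
    ... | no l≢i with refl ← rows l l≢i | point i w ≟ⱽ point i u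
    ...   | yes eq = inj₂ (cong (point j) (sym (proj₂ (point-injective eq))))
    ...   | no w≢u = contradiction (cong (point j) (columns u w≢u)) v≢z

-- Constructions

Edgeless : (n : ℕ) → Graph (Fin n)
Edgeless n = complement (Complete n)

-- The complete multipartite graph with `n` parts of size two: a 4-cycle for `n` equal to 2 and the
-- octahedron for 3.
CocktailParty : (n : ℕ) → Graph (Fin n × Fin 2)
CocktailParty n = record
  { Adj    = λ (i , _) (j , _) → i ≢ j
  ; symm   = ≢-sym
  ; irrefl = λ i≢i → i≢i refl
  ; _≟_    = Product.≡-dec _≟ᶠ_ _≟ᶠ_
  ; adj?   = λ (i , _) (j , _) → ¬? (i ≟ᶠ j)
  }

TS₁-≅ : (G : Graph (Fin N)) → TS 1 G ≅ G
TS₁-≅ G = TS≅ {H = G} {G} ⁅_⁆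
  (λ x → ∣⁅x⁆∣≡1 x , λ u v u∈ v∈ u≢v → contradiction (trans (x∈⁅y⁆⇒x≡y x u∈) (sym (x∈⁅y⁆⇒x≡y x v∈))) u≢v)
  (λ {u} {v} eq → x∈⁅y⁆⇒x≡y v (subst (u ∈_) eq (x∈⁅x⁆ u)))
  (λ S (∣S∣≡1 , _) → ∣p∣≡1⇒p≡⁅x⁆ S ∣S∣≡1)
  λ u v → mk⇔
    (λ s → subst₂ (Adj G) (x∈⁅y⁆⇒x≡y u (from∈ s)) (x∈⁅y⁆⇒x≡y v (to∈ s)) (edge s))
    (λ uv → record
      { from  = u
      ; to    = v
      ; from∈ = x∈⁅x⁆ u
      ; from∉ = λ u∈⁅v⁆ → Graph.irrefl G (subst (λ w → Adj G w v) (x∈⁅y⁆⇒x≡y v u∈⁅v⁆) uv)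
      ; to∈   = x∈⁅x⁆ v
      ; to∉   = λ v∈⁅u⁆ → Graph.irrefl G (subst (Adj G u) (x∈⁅y⁆⇒x≡y u v∈⁅u⁆) uv)
      ; A∖B   = λ x∈ _ → x∈⁅y⁆⇒x≡y u x∈
      ; B∖A   = λ x∈ _ → x∈⁅y⁆⇒x≡y v x∈
      ; edge  = uv
      })

realize-1 : Fin N ↔ V → (G : Graph V) → Realizable 1 G
realize-1 {N} f G = N , relabel f G , ≅-trans {G = TS 1 (relabel f G)} {relabel f G} {G} (TS₁-≅ (relabel f G)) (relabel-≅ f G)

-- The only `k`-clique of `Complete k` is its full vertex set; this supplies isolated vertices for
-- every `k`.
realize-K₁ : ∀ k → Realizable k (Complete 1)
realize-K₁ k = k , Complete k , TS≅ {H = Complete k} {Complete 1} (λ _ → ⊤)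
  (λ _ → ∣⊤∣≡n k , λ _ _ _ _ → id)
  (λ { {0F} {0F} _ → refl })
  (λ S (∣S∣≡k , _) → 0F , sym (∣p∣≡n⇒p≡⊤ ∣S∣≡k))
  λ { 0F 0F → mk⇔ (λ s → contradiction ∈⊤ (from∉ s)) (λ 0≢0 → contradiction refl 0≢0) }

-- A `k`-clique of the host is determined by the one vertex it omits, and one slide into this hole
-- reaches any other `k`-clique.
realize-K₁₊ₖ : ∀ k → Realizable k (Complete (suc k))
realize-K₁₊ₖ k = suc k , Complete (suc k) , TS≅ {H = Complete (suc k)} {Complete (suc k)} (λ i → ∁ ⁅ i ⁆)
  (λ i → trans (∣∁p∣≡n∸∣p∣ ⁅ i ⁆) (cong (suc k ∸_) (∣⁅x⁆∣≡1 i)) , λ _ _ _ _ → id)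
  (λ {i} {j} eq → decidable-stable (i ≟ᶠ j) λ i≢j → i∉∁ i (subst (i ∈_) (sym eq) (i∈∁ i≢j)))
  co-singleton
  λ i j → mk⇔
    (λ s i≡j → from∉ s (subst (λ l → from s ∈ ∁ ⁅ l ⁆) i≡j (from∈ s)))
    (λ i≢j → record
      -- The clique named `i` has its hole at `i`, so the token on `j` moves there and leaves the
      -- hole at `j`.
      { from  = j
      ; to    = i
      ; from∈ = i∈∁ (≢-sym i≢j)
      ; from∉ = i∉∁ j
      ; to∈   = i∈∁ i≢j
      ; to∉   = i∉∁ i
      ; A∖B   = λ _ x∉ → x∈⁅y⁆⇒x≡y j (x∉∁p⇒x∈p x∉)
      ; B∖A   = λ _ x∉ → x∈⁅y⁆⇒x≡y i (x∉∁p⇒x∈p x∉)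
      ; edge  = ≢-sym i≢j
      })
  where
  i∉∁ : ∀ i → i ∉ ∁ ⁅ i ⁆
  i∉∁ i i∈ = x∈∁p⇒x∉p i∈ (x∈⁅x⁆ i)

  i∈∁ : ∀ {i j} → i ≢ j → i ∈ ∁ ⁅ j ⁆
  i∈∁ i≢j = x∉p⇒x∈∁p (x≢y⇒x∉⁅y⁆ i≢j)

  co-singleton : ∀ S → IsClique (Complete (suc k)) k S → ∃[ i ] ∁ ⁅ i ⁆ ≡ S
  co-singleton S (∣S∣≡k , _) with ∣p∣≡1⇒p≡⁅x⁆ (∁ S) (trans (∣∁p∣≡n∸∣p∣ S) (trans (cong (suc k ∸_) ∣S∣≡k) (m+n∸n≡m 1 k)))
  ... | i , eq = i , ⊆-antisym
    (λ x∈ → x∉∁p⇒x∈p (subst (_ ∉_) eq (x∈∁p⇒x∉p x∈)))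
    (λ x∈S → x∉p⇒x∈∁p λ x∈⁅i⁆ → x∈∁p⇒x∉p (subst (_ ∈_) eq x∈⁅i⁆) x∈S)

-- Token Sliding on disjoint unions

record InducedSubgraph (K : Graph (Fin m)) (H : Graph (Fin n)) : Set₁ where
  field
    ι           : Fin m → Fin n
    ι-injective : ∀ {x y} → ι x ≡ ι y → x ≡ y
    ι-adj       : ∀ x y → Adj H (ι x) (ι y) ⇔ Adj K x y
    -- The image is given as data, so that `left` and `right` can supply it as padding by `⊥` while
    -- the transfer of cliques and slides is proved once for both.
    image       : Subset m → Subset n
    ∈-image⁺    : ∀ {p x} → x ∈ p → ι x ∈ image p
    ∈-image⁻    : ∀ {p y} → y ∈ image p → ∃[ x ] y ≡ ι x × x ∈ p
    ∣image∣     : ∀ p → ∣ image p ∣ ≡ ∣ p ∣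

  ι∈-image⁻ : ∀ {p x} → ι x ∈ image p → x ∈ p
  ι∈-image⁻ ιx∈ with _ , eq , x∈p ← ∈-image⁻ ιx∈ = subst (_∈ _) (sym (ι-injective eq)) x∈p

  image-injective : ∀ {p q} → image p ≡ image q → p ≡ q
  image-injective eq = ⊆-antisym
    (λ {x} x∈p → ι∈-image⁻ (subst (ι x ∈_) eq (∈-image⁺ x∈p)))
    (λ {x} x∈q → ι∈-image⁻ (subst (ι x ∈_) (sym eq) (∈-image⁺ x∈q)))

  image-clique : ∀ {p} → IsClique K k p → IsClique H k (image p)
  image-clique (∣p∣≡k , adj) = trans (∣image∣ _) ∣p∣≡k , λ u v u∈ v∈ u≢v → image-adj (∈-image⁻ u∈) (∈-image⁻ v∈) u≢v
    where
    image-adj : ∀ {u v} → ∃[ x ] u ≡ ι x × x ∈ _ → ∃[ y ] v ≡ ι y × y ∈ _ → u ≢ v → Adj H u v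
    image-adj (x , refl , x∈p) (y , refl , y∈p) u≢v = Equivalence.from (ι-adj x y) (adj x y x∈p y∈p (u≢v ∘ cong ι))

  image-clique⁻ : ∀ {p} → IsClique H k (image p) → IsClique K k p
  image-clique⁻ (∣p∣≡k , adj) = trans (sym (∣image∣ _)) ∣p∣≡k , λ x y x∈p y∈p x≢y →
    Equivalence.to (ι-adj x y) (adj (ι x) (ι y) (∈-image⁺ x∈p) (∈-image⁺ y∈p) (x≢y ∘ ι-injective))

  image-slide : ∀ p q → Slide H (image p) (image q) ⇔ Slide K p q
  image-slide p q = mk⇔ pull push
    where
    pull : Slide H (image p) (image q) → Slide K p q
    pull s with ∈-image⁻ (from∈ s) | ∈-image⁻ (to∈ s)
    ... | x , u≡ιx , x∈p | y , v≡ιy , y∈q = record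
      { from  = x
      ; to    = y
      ; from∈ = x∈p
      ; from∉ = λ x∈q → from∉ s (subst (_∈ image q) (sym u≡ιx) (∈-image⁺ x∈q))
      ; to∈   = y∈q
      ; to∉   = λ y∈p → to∉ s (subst (_∈ image p) (sym v≡ιy) (∈-image⁺ y∈p))
      ; A∖B   = λ z∈p z∉q → ι-injective (trans (A∖B s (∈-image⁺ z∈p) (λ ιz∈ → z∉q (ι∈-image⁻ ιz∈))) u≡ιx)
      ; B∖A   = λ z∈q z∉p → ι-injective (trans (B∖A s (∈-image⁺ z∈q) (λ ιz∈ → z∉p (ι∈-image⁻ ιz∈))) v≡ιy)
      ; edge  = Equivalence.to (ι-adj x y) (subst₂ (Adj H) u≡ιx v≡ιy (edge s))
      }

    only : ∀ {p q x} → (∀ {z} → z ∈ p → z ∉ q → z ≡ x) → ∀ {y} → y ∈ image p → y ∉ image q → y ≡ ι x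
    only p∖q y∈ y∉ with z , refl , z∈p ← ∈-image⁻ y∈ = cong ι (p∖q z∈p (y∉ ∘ ∈-image⁺))

    push : Slide K p q → Slide H (image p) (image q)
    push s = record
      { from  = ι (from s)
      ; to    = ι (to s)
      ; from∈ = ∈-image⁺ (from∈ s)
      ; from∉ = λ ιx∈ → from∉ s (ι∈-image⁻ ιx∈)
      ; to∈   = ∈-image⁺ (to∈ s)
      ; to∉   = λ ιx∈ → to∉ s (ι∈-image⁻ ιx∈)
      ; A∖B   = only (A∖B s)
      ; B∖A   = only (B∖A s)
      ; edge  = Equivalence.from (ι-adj (from s) (to s)) (edge s)
      }

module _ (H₁ : Graph (Fin m)) (H₂ : Graph (Fin n)) where

  union : Graph (Fin (m + n))
  union = relabel +↔⊎ (H₁ ⊔ᴳ H₂)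

  left : InducedSubgraph H₁ union
  left = record
    { ι           = _↑ˡ n
    ; ι-injective = ↑ˡ-injective n _ _
    ; ι-adj       = λ x y → subst₂ (λ a b → Adj (H₁ ⊔ᴳ H₂) a b ⇔ Adj H₁ x y) (sym (splitAt-↑ˡ m x n)) (sym (splitAt-↑ˡ m y n)) (⇔-id _)
    ; image       = _++ ⊥
    ; ∈-image⁺    = λ {p} {x} x∈p → lookup⇒[]= (x ↑ˡ n) _ (trans (lookup-++ˡ p ⊥ x) ([]=⇒lookup x∈p))
    ; ∈-image⁻    = image⁻
    ; ∣image∣     = λ p → trans (∣p++q∣≡∣p∣+∣q∣ p ⊥) (trans (cong (∣ p ∣ +_) (∣⊥∣≡0 n)) (+-identityʳ ∣ p ∣))
    }
    where
    image⁻ : ∀ {p y} → y ∈ p ++ ⊥ → ∃[ x ] y ≡ x ↑ˡ n × x ∈ p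
    image⁻ {p} {y} y∈ with splitAt m y in eq
    ... | inj₁ x with refl ← splitAt⁻¹-↑ˡ eq = x , refl , lookup⇒[]= x p (trans (sym (lookup-++ˡ p ⊥ x)) ([]=⇒lookup y∈))
    ... | inj₂ x with refl ← splitAt⁻¹-↑ʳ eq = contradiction (lookup⇒[]= x ⊥ (trans (sym (lookup-++ʳ p ⊥ x)) ([]=⇒lookup y∈))) ∉⊥

  right : InducedSubgraph H₂ union
  right = record
    { ι           = m ↑ʳ_
    ; ι-injective = ↑ʳ-injective m _ _
    ; ι-adj       = λ x y → subst₂ (λ a b → Adj (H₁ ⊔ᴳ H₂) a b ⇔ Adj H₂ x y) (sym (splitAt-↑ʳ m n x)) (sym (splitAt-↑ʳ m n y)) (⇔-id _)
    ; image       = ⊥ {m} ++_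
    ; ∈-image⁺    = λ {p} {x} x∈p → lookup⇒[]= (m ↑ʳ x) _ (trans (lookup-++ʳ (⊥ {m}) p x) ([]=⇒lookup x∈p))
    ; ∈-image⁻    = image⁻
    ; ∣image∣     = λ p → trans (∣p++q∣≡∣p∣+∣q∣ (⊥ {m}) p) (cong (_+ ∣ p ∣) (∣⊥∣≡0 m))
    }
    where
    image⁻ : ∀ {p y} → y ∈ ⊥ {m} ++ p → ∃[ x ] y ≡ m ↑ʳ x × x ∈ p
    image⁻ {p} {y} y∈ with splitAt m y in eq
    ... | inj₁ x with refl ← splitAt⁻¹-↑ˡ eq = contradiction (lookup⇒[]= x ⊥ (trans (sym (lookup-++ˡ (⊥ {m}) p x)) ([]=⇒lookup y∈))) ∉⊥
    ... | inj₂ x with refl ← splitAt⁻¹-↑ʳ eq = x , refl , lookup⇒[]= x p (trans (sym (lookup-++ʳ (⊥ {m}) p x)) ([]=⇒lookup y∈))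

  left≁right : ∀ {x y} → ¬ Adj union (x ↑ˡ n) (m ↑ʳ y)
  left≁right {x} {y} = subst₂ (λ a b → ¬ Adj (H₁ ⊔ᴳ H₂) a b) (sym (splitAt-↑ˡ m x n)) (sym (splitAt-↑ʳ m n y)) λ ()

  left≢right : ∀ {x y} → x ↑ˡ n ≢ m ↑ʳ y
  left≢right {x} {y} eq with () ← trans (sym (splitAt-↑ˡ m x n)) (trans (cong (splitAt m) eq) (splitAt-↑ʳ m n y))

  module L = InducedSubgraph left
  module R = InducedSubgraph right

  -- There are no edges between the two sides, so no clique meets both and no token can cross over.
  TS-union : 1 ≤ k → TS k union ≅ TS k H₁ ⊔ᴳ TS k H₂
  TS-union {k} 1≤k = TS≅ {H = union} {TS k H₁ ⊔ᴳ TS k H₂} f f-clique f-injective f-surjective f-adj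
    where
    f : Clique H₁ k ⊎ Clique H₂ k → Subset (m + n)
    f (inj₁ A) = L.image (value A)
    f (inj₂ B) = R.image (value B)

    f-clique : ∀ A → IsClique union k (f A)
    f-clique (inj₁ A) = L.image-clique (isClique H₁ A)
    f-clique (inj₂ B) = R.image-clique (isClique H₂ B)

    -- Here `1 ≤ k` matters: the empty clique would have the same image from either side.
    images-distinct : ∀ (A : Clique H₁ k) (B : Clique H₂ k) → L.image (value A) ≢ R.image (value B)
    images-distinct A B eq with x , x∈A ← 1≤∣p∣⇒Nonempty (value A) (subst (1 ≤_) (sym (proj₁ (isClique H₁ A))) 1≤k)
      with y , x≡y , _ ← R.∈-image⁻ (subst (x ↑ˡ n ∈_) eq (L.∈-image⁺ x∈A)) = left≢right x≡y

    f-injective : ∀ {A B} → f A ≡ f B → A ≡ B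
    f-injective {inj₁ A} {inj₁ B} eq = cong inj₁ (value-injective (L.image-injective eq))
    f-injective {inj₁ A} {inj₂ B} eq = contradiction eq (images-distinct A B)
    f-injective {inj₂ A} {inj₁ B} eq = contradiction (sym eq) (images-distinct B A)
    f-injective {inj₂ A} {inj₂ B} eq = cong inj₂ (value-injective (R.image-injective eq))

    f-surjective : ∀ S → IsClique union k S → ∃[ A ] f A ≡ S
    f-surjective S S-clique with Vec.splitAt m S
    ... | p , q , refl with nonempty? p
    ...   | no p-empty with refl ← Empty-unique p-empty = inj₂ (q , [ R.image-clique⁻ S-clique ]) , refl
    ...   | yes (x , x∈p) with refl ← Empty-unique {p = q} (λ (y , y∈q) → left≁right (proj₂ S-clique (x ↑ˡ n) (m ↑ʳ y)
              (lookup⇒[]= _ _ (trans (lookup-++ˡ p q x) ([]=⇒lookup x∈p)))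
              (lookup⇒[]= _ _ (trans (lookup-++ʳ p q y) ([]=⇒lookup y∈q))) left≢right))
            = inj₁ (p , [ L.image-clique⁻ S-clique ]) , refl

    f-adj : ∀ A B → Slide union (f A) (f B) ⇔ Adj (TS k H₁ ⊔ᴳ TS k H₂) A B
    f-adj (inj₁ A) (inj₁ B) = mk⇔ slide⇒TSAdj TSAdj⇒slide ⇔-∘ L.image-slide (value A) (value B)
    f-adj (inj₁ A) (inj₂ B) = mk⇔ no-slide λ ()
      where
      no-slide : ¬ Slide union (f (inj₁ A)) (f (inj₂ B))
      no-slide s with x , u≡ , _ ← L.∈-image⁻ (from∈ s) | y , v≡ , _ ← R.∈-image⁻ (to∈ s) = left≁right (subst₂ (Adj union) u≡ v≡ (edge s))
    f-adj (inj₂ A) (inj₁ B) = mk⇔ no-slide λ ()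
      where
      no-slide : ¬ Slide union (f (inj₂ A)) (f (inj₁ B))
      no-slide s with x , u≡ , _ ← R.∈-image⁻ (from∈ s) | y , v≡ , _ ← L.∈-image⁻ (to∈ s) =
        left≁right (Graph.symm union {m ↑ʳ x} {y ↑ˡ n} (subst₂ (Adj union) u≡ v≡ (edge s)))
    f-adj (inj₂ A) (inj₂ B) = mk⇔ slide⇒TSAdj TSAdj⇒slide ⇔-∘ R.image-slide (value A) (value B)

realize-⊔ : {G : Graph V} {G′ : Graph W} → 1 ≤ k → Realizable k G → Realizable k G′ → Realizable k (G ⊔ᴳ G′)
realize-⊔ {k = k} {G} {G′} 1≤k (m , H₁ , e₁) (n , H₂ , e₂) = m + n , union H₁ H₂ ,
  ≅-trans {G = TS k (union H₁ H₂)} {TS k H₁ ⊔ᴳ TS k H₂} {G ⊔ᴳ G′} (TS-union H₁ H₂ 1≤k)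
    (⊔ᴳ-cong {G = TS k H₁} {G} {TS k H₂} {G′} e₁ e₂)

Edgeless-suc : ∀ n → Complete 1 ⊔ᴳ Edgeless n ≅ Edgeless (suc n)
Edgeless-suc n = ≅-sym {G = Edgeless (suc n)} {Complete 1 ⊔ᴳ Edgeless n} (+↔⊎ {1} {n} , adj)
  where
  adj : ∀ u v → Adj (Edgeless (suc n)) u v ⇔ Adj (Complete 1 ⊔ᴳ Edgeless n) (splitAt 1 u) (splitAt 1 v)
  adj zero    zero    = mk⇔ (λ (0≢0 , _) → contradiction refl 0≢0) (λ 0≢0 → contradiction refl 0≢0)
  adj zero    (suc v) = mk⇔ (λ (a , b) → b a) λ ()
  adj (suc u) zero    = mk⇔ (λ (a , b) → b a) λ ()
  adj (suc u) (suc v) = mk⇔ (λ (a , b) → contradiction a b) (λ (a , b) → contradiction a b)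

-- Each isolated vertex is contributed by its own component `Complete k` of the host.
realize-Edgeless : 1 ≤ k → ∀ n → Realizable k (Edgeless n)
realize-Edgeless {k} 1≤k (suc n) = realizable-≅ {G = Complete 1 ⊔ᴳ Edgeless n} {Edgeless (suc n)} (Edgeless-suc n)
  (realize-⊔ {G = Complete 1} {Edgeless n} 1≤k (realize-K₁ k) (realize-Edgeless 1≤k n))
-- On no vertices the only subset is empty, and its size 0 is not `suc k`.
realize-Edgeless {suc k} _ zero = 0 , Complete 0 , TS≅ {H = Complete 0} {Edgeless 0} (λ ()) (λ ()) (λ { {()} }) (λ { [] (() , _) }) (λ ())

-- The 2-cliques of `Complete 4` are its six edges. Two distinct ones are related by a slide unless
-- they are disjoint, so the non-edges form three pairs.
realize-octahedron : Realizable 2 (CocktailParty 3)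
realize-octahedron = 4 , Complete 4 , TS≅ {H = Complete 4} {CocktailParty 3} pair clique injective surjective λ u v →
  mk⇔ (proj₁ (adj u v) ∘ slide⇒TSAdj) (TSAdj⇒slide ∘ proj₂ (adj u v))
  where
  -- Non-adjacent vertices of the octahedron are complementary pairs.
  pair : Fin 3 × Fin 2 → Subset 4
  pair (0F , 0F) = true  ∷ true  ∷ false ∷ false ∷ []
  pair (0F , 1F) = false ∷ false ∷ true  ∷ true  ∷ []
  pair (1F , 0F) = true  ∷ false ∷ true  ∷ false ∷ []
  pair (1F , 1F) = false ∷ true  ∷ false ∷ true  ∷ []
  pair (2F , 0F) = true  ∷ false ∷ false ∷ true  ∷ []
  pair (2F , 1F) = false ∷ true  ∷ true  ∷ false ∷ []

  clique : ∀ v → IsClique (Complete 4) 2 (pair v)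
  clique (i , a) = from-yes (all? λ i → all? λ a → ∣ pair (i , a) ∣ ≟ⁿ 2) i a , λ _ _ _ _ → id

  injective : ∀ {u v} → pair u ≡ pair v → u ≡ v
  injective {i , a} {j , b} = from-yes (all? λ i → all? λ a → all? λ j → all? λ b →
    ≡-dec _≟ᵇ_ (pair (i , a)) (pair (j , b)) →-dec Product.≡-dec _≟ᶠ_ _≟ᶠ_ (i , a) (j , b)) i a j b

  surjective : ∀ S → IsClique (Complete 4) 2 S → ∃[ v ] pair v ≡ S
  surjective (true  ∷ true  ∷ false ∷ false ∷ []) _ = (0F , 0F) , refl
  surjective (false ∷ false ∷ true  ∷ true  ∷ []) _ = (0F , 1F) , refl
  surjective (true  ∷ false ∷ true  ∷ false ∷ []) _ = (1F , 0F) , refl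
  surjective (false ∷ true  ∷ false ∷ true  ∷ []) _ = (1F , 1F) , refl
  surjective (true  ∷ false ∷ false ∷ true  ∷ []) _ = (2F , 0F) , refl
  surjective (false ∷ true  ∷ true  ∷ false ∷ []) _ = (2F , 1F) , refl
  -- The remaining ten subsets do not have size 2.
  surjective (false ∷ false ∷ false ∷ false ∷ []) (() , _)
  surjective (false ∷ false ∷ false ∷ true  ∷ []) (() , _)
  surjective (false ∷ false ∷ true  ∷ false ∷ []) (() , _)
  surjective (false ∷ true  ∷ false ∷ false ∷ []) (() , _)
  surjective (false ∷ true  ∷ true  ∷ true  ∷ []) (() , _)
  surjective (true  ∷ false ∷ false ∷ false ∷ []) (() , _)
  surjective (true  ∷ false ∷ true  ∷ true  ∷ []) (() , _)
  surjective (true  ∷ true  ∷ false ∷ true  ∷ []) (() , _)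
  surjective (true  ∷ true  ∷ true  ∷ false ∷ []) (() , _)
  surjective (true  ∷ true  ∷ true  ∷ true  ∷ []) (() , _)

  adj : ∀ u v → (TSAdj (Complete 4) (pair u) (pair v) → Adj (CocktailParty 3) u v) × (Adj (CocktailParty 3) u v → TSAdj (Complete 4) (pair u) (pair v))
  -- A finite check: the decision procedures for both adjacencies are evaluated on all 36 pairs.
  adj (i , a) (j , b) = from-yes (all? λ i → all? λ a → all? λ j → all? λ b →
    let slide? = Graph.adj? (TS 2 (Complete 4)) (pair (i , a) , [ clique (i , a) ]) (pair (j , b) , [ clique (j , b) ])
        adj?   = Graph.adj? (CocktailParty 3) (i , a) (j , b)
    in (slide? →-dec adj?) ×-dec (adj? →-dec slide?)) i a j b

-- The graph families

complement-K-≅ : ∀ m n → Complete m ⊔ᴳ Complete n ≅ complement (CompleteBipartite m n)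
complement-K-≅ m n = ≅-fromAdj {G = Complete m ⊔ᴳ Complete n} {complement (CompleteBipartite m n)} λ
  { (inj₁ a) (inj₁ b) → mk⇔ (λ a≢b → a≢b ∘ Sum.inj₁-injective , λ ()) (λ (ne , _) → ne ∘ cong inj₁)
  ; (inj₁ a) (inj₂ b) → mk⇔ (λ ()) (λ (_ , ≁) → ≁ tt)
  ; (inj₂ a) (inj₁ b) → mk⇔ (λ ()) (λ (_ , ≁) → ≁ tt)
  ; (inj₂ a) (inj₂ b) → mk⇔ (λ a≢b → a≢b ∘ Sum.inj₂-injective , λ ()) (λ (ne , _) → ne ∘ cong inj₂)
  }

complement-B-≅ : ∀ p → Edgeless 2 ⊔ᴳ Complete p ≅ complement (Book p)
complement-B-≅ p = ≅-fromAdj {G = Edgeless 2 ⊔ᴳ Complete p} {complement (Book p)} λ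
  { (inj₁ a) (inj₁ b) → mk⇔ (λ (a≢b , ¬a≢b) → contradiction a≢b ¬a≢b) (λ (ne , ¬a≢b) → ne ∘ cong inj₁ , ¬a≢b)
  ; (inj₁ a) (inj₂ b) → mk⇔ (λ ()) (λ (_ , ≁) → ≁ tt)
  ; (inj₂ a) (inj₁ b) → mk⇔ (λ ()) (λ (_ , ≁) → ≁ tt)
  ; (inj₂ a) (inj₂ b) → mk⇔ (λ a≢b → a≢b ∘ Sum.inj₂-injective , λ ()) (λ (ne , _) → ne ∘ cong inj₂)
  }

-- Complementing isolates the hub; among the other vertices the only non-edges join two vertices of
-- one triangle.
complement-F-≅ : ∀ p → Complete 1 ⊔ᴳ CocktailParty p ≅ complement (Friendship p)
complement-F-≅ p = ↔-sym relabelling , adj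
  where
  relabelling : (Unit ⊎ Fin p × Fin 2) ↔ (Fin 1 ⊎ Fin p × Fin 2)
  relabelling = ↔-sym 1↔⊤ ⊎-↔ ↔-id _

  adj : ∀ u v → Adj (Complete 1 ⊔ᴳ CocktailParty p) u v ⇔ Adj (complement (Friendship p)) (Inverse.from relabelling u) (Inverse.from relabelling v)
  adj (inj₁ 0F) (inj₁ 0F) = mk⇔ (λ 0≢0 → contradiction refl 0≢0) (λ (ne , _) → contradiction refl ne)
  adj (inj₁ _)  (inj₂ _)  = mk⇔ (λ ()) (λ (_ , ≁) → ≁ tt)
  adj (inj₂ _)  (inj₁ _)  = mk⇔ (λ ()) (λ (_ , ≁) → ≁ tt)
  adj (inj₂ (i , a)) (inj₂ (j , b)) = mk⇔
    (λ i≢j → (λ { refl → i≢j refl }) , i≢j ∘ proj₁)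
    (λ { (ne , ≁) refl → ≁ (refl , λ { refl → ne refl }) })

Fin1-unique : (i j : Fin 1) → i ≡ j
Fin1-unique 0F 0F = refl

CocktailParty-1-≅ : Edgeless 2 ≅ CocktailParty 1
CocktailParty-1-≅ = *↔× {1} {2} , λ u v → mk⇔
  (λ (u≢v , ¬u≢v) → contradiction u≢v ¬u≢v)
  (λ i≢j → contradiction (Fin1-unique _ _) i≢j)

-- The neighbours of `ι 0F` are the other `n` vertices of its component and form a clique, so
-- `clique-neighbourhood-size` applies.
complete-component : {G : Graph V} (ι : Fin (suc n) → V) → (∀ {i j} → ι i ≡ ι j → i ≡ j) →
                     (∀ i j → i ≢ j → Adj G (ι i) (ι j)) → (∀ {y} → Adj G (ι 0F) y → ∃[ i ] y ≡ ι i) →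
                     1 ≤ n → 2 ≤ k → Realizable k G → n ≡ k
complete-component {n = n} {G = G} ι ι-injective ι-adj ι-closed 1≤n 2≤k R =
  clique-neighbourhood-size (realizable-neighbourhood {G = G} R (ι 0F)) 2≤k (ι ∘ suc)
    (Fin-suc-injective ∘ ι-injective)
    (λ i → ι-adj 0F (suc i) λ ())
    cover
    (λ i j i≢j → ι-adj (suc i) (suc j) (i≢j ∘ Fin-suc-injective))
    1≤n
  where
  cover : ∀ {y} → Adj G (ι 0F) y → ∃[ i ] y ≡ ι (suc i)
  cover a with ι-closed a
  ... | zero  , refl = contradiction a (Graph.irrefl G)
  ... | suc i , eq   = i , eq

complete-component-left : (G : Graph V) → 1 ≤ n → 2 ≤ k → Realizable k (Complete (suc n) ⊔ᴳ G) → n ≡ k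
complete-component-left G = complete-component {G = Complete _ ⊔ᴳ G} inj₁ Sum.inj₁-injective (λ _ _ → id) λ { {inj₁ i} _ → i , refl }

complete-component-right : (G : Graph V) → 1 ≤ n → 2 ≤ k → Realizable k (G ⊔ᴳ Complete (suc n)) → n ≡ k
complete-component-right G = complete-component {G = G ⊔ᴳ Complete _} inj₂ Sum.inj₂-injective (λ _ _ → id) λ { {inj₂ i} _ → i , refl }

edge-not-in-triangle : (G : Graph V) {x y : V} → Adj G x y → ¬ (∃[ z ] Adj G x z × Adj G y z) → 2 ≤ k → ¬ Realizable k G
edge-not-in-triangle G {x} xy ∄z 2≤k R = ∄z (edge-in-triangle (realizable-neighbourhood {G = G} R x) 2≤k xy)

-- By `unique-nonneighbour`, every neighbour of `x` other than `y` and `z` is adjacent to `z`; the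
-- vertex `v` violates this.
second-nonneighbour : (G : Graph V) {x y z v : V} → Adj G x y → Adj G x z → Adj G x v → y ≢ z → v ≢ y → v ≢ z → ¬ Adj G y z → ¬ Adj G z v →
                      (∀ {u} → Adj G x u → u ≢ y → ¬ Adj G y u → u ≡ z) → 2 ≤ k → ¬ Realizable k G
second-nonneighbour G {x} xy xz xv y≢z v≢y v≢z y≁z z≁v unique 2≤k R
  with _ , p , q , (_ , zp) , (_ , zq) , cover ← unique-nonneighbour (realizable-neighbourhood {G = G} R x) 2≤k xy xz y≢z y≁z unique
  with cover xv v≢y v≢z
... | inj₁ refl = z≁v zp
... | inj₂ refl = z≁v zq

-- For 3 or 4 vertices the edge from 0 to 2 lies in no triangle. From 5 on, among the neighbours of
-- 0 the vertex 2 misses only 3, because 1 is not a neighbour of 0, while 3 also misses 4.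
path-unrealizable : 3 ≤ n → 2 ≤ k → ¬ Realizable k (complement (Path n))
path-unrealizable {3} (s≤s (s≤s (s≤s _))) = edge-not-in-triangle G {0F} {2F} (from-yes (G.adj? 0F 2F)) (from-no (any? λ z → G.adj? 0F z ×-dec G.adj? 2F z))
  where
  G = complement (Path 3)
  module G = Graph G
path-unrealizable {4} (s≤s (s≤s (s≤s _))) = edge-not-in-triangle G {0F} {2F} (from-yes (G.adj? 0F 2F)) (from-no (any? λ z → G.adj? 0F z ×-dec G.adj? 2F z))
  where
  G = complement (Path 4)
  module G = Graph G
path-unrealizable {suc (suc (suc (suc (suc n))))} (s≤s (s≤s (s≤s _))) =
  second-nonneighbour G {0F} {2F} {3F} {4F} 0~2 0~3 0~4 (λ ()) (λ ()) (λ ()) (λ (_ , ≁) → ≁ (inj₁ refl)) (λ (_ , ≁) → ≁ (inj₁ refl)) unique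
  where
  G = complement (Path (5 + n))

  0~2 : Adj G 0F 2F
  0~2 = (λ ()) , λ { (inj₁ ()) ; (inj₂ ()) }

  0~3 : Adj G 0F 3F
  0~3 = (λ ()) , λ { (inj₁ ()) ; (inj₂ ()) }

  0~4 : Adj G 0F 4F
  0~4 = (λ ()) , λ { (inj₁ ()) ; (inj₂ ()) }

  unique : ∀ {v} → Adj G 0F v → v ≢ 2F → ¬ Adj G 2F v → v ≡ 3F
  unique {0F} (0≢0 , _) _ _ = contradiction refl 0≢0
  unique {1F} (_ , ≁) _ _ = contradiction (inj₁ refl) ≁
  unique {2F} _ 2≢2 _ = contradiction refl 2≢2
  unique {3F} _ _ _ = refl
  unique {suc (suc (suc (suc v)))} _ _ 2≁v = contradiction ((λ ()) , λ { (inj₁ ()) ; (inj₂ ()) }) 2≁v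

-- The path argument works again. The general case starts at 6, where 4 is not yet the cyclic
-- predecessor of 0 and hence is a neighbour of 0 in the complement.
cycle-unrealizable : 4 ≤ n → 2 ≤ k → ¬ Realizable k (complement (Cycle n))
cycle-unrealizable {4} (s≤s (s≤s (s≤s (s≤s _)))) = edge-not-in-triangle G {0F} {2F} (from-yes (G.adj? 0F 2F)) (from-no (any? λ z → G.adj? 0F z ×-dec G.adj? 2F z))
  where
  G = complement (Cycle 4)
  module G = Graph G
cycle-unrealizable {5} (s≤s (s≤s (s≤s (s≤s _)))) = edge-not-in-triangle G {0F} {2F} (from-yes (G.adj? 0F 2F)) (from-no (any? λ z → G.adj? 0F z ×-dec G.adj? 2F z))
  where
  G = complement (Cycle 5)
  module G = Graph G
cycle-unrealizable {suc (suc (suc (suc (suc (suc n)))))} (s≤s (s≤s (s≤s (s≤s _)))) =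
  second-nonneighbour G {0F} {2F} {3F} {4F} 0~2 0~3 0~4 (λ ()) (λ ()) (λ ())
    (λ (_ , ≁) → ≁ ((λ ()) , inj₁ (inj₁ refl))) (λ (_ , ≁) → ≁ ((λ ()) , inj₁ (inj₁ refl))) unique
  where
  G = complement (Cycle (6 + n))

  0~2 : Adj G 0F 2F
  0~2 = (λ ()) , λ { (_ , inj₁ (inj₁ ())) ; (_ , inj₁ (inj₂ ())) ; (_ , inj₂ (inj₁ ())) ; (_ , inj₂ (inj₂ ())) }

  0~3 : Adj G 0F 3F
  0~3 = (λ ()) , λ { (_ , inj₁ (inj₁ ())) ; (_ , inj₁ (inj₂ ())) ; (_ , inj₂ (inj₁ ())) ; (_ , inj₂ (inj₂ ())) }

  0~4 : Adj G 0F 4F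
  0~4 = (λ ()) , λ { (_ , inj₁ (inj₁ ())) ; (_ , inj₁ (inj₂ ())) ; (_ , inj₂ (inj₁ ())) ; (_ , inj₂ (inj₂ ())) }

  unique : ∀ {v} → Adj G 0F v → v ≢ 2F → ¬ Adj G 2F v → v ≡ 3F
  unique {0F} (0≢0 , _) _ _ = contradiction refl 0≢0
  unique {1F} (_ , ≁) _ _ = contradiction ((λ ()) , inj₁ (inj₁ refl)) ≁
  unique {2F} _ 2≢2 _ = contradiction refl 2≢2
  unique {3F} _ _ _ = refl
  unique {suc (suc (suc (suc v)))} _ _ 2≁v = contradiction
    ((λ ()) , λ { (_ , inj₁ (inj₁ ())) ; (_ , inj₁ (inj₂ ())) ; (_ , inj₂ (inj₁ ())) ; (_ , inj₂ (inj₂ (_ , ()))) }) 2≁v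

no-three-in-two : {a b c p q : V} → a ≢ b → a ≢ c → b ≢ c → a ≡ p ⊎ a ≡ q → b ≡ p ⊎ b ≡ q → c ≡ p ⊎ c ≡ q → Empty
no-three-in-two a≢b a≢c b≢c (inj₁ refl) (inj₁ refl) _           = a≢b refl
no-three-in-two a≢b a≢c b≢c (inj₁ refl) (inj₂ refl) (inj₁ refl) = a≢c refl
no-three-in-two a≢b a≢c b≢c (inj₁ refl) (inj₂ refl) (inj₂ refl) = b≢c refl
no-three-in-two a≢b a≢c b≢c (inj₂ refl) (inj₁ refl) (inj₁ refl) = b≢c refl
no-three-in-two a≢b a≢c b≢c (inj₂ refl) (inj₁ refl) (inj₂ refl) = a≢c refl
no-three-in-two a≢b a≢c b≢c (inj₂ refl) (inj₂ refl) _           = a≢b refl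

module _ (p : ℕ) where

  private G = Complete 1 ⊔ᴳ CocktailParty (3 + p)

  -- Around `(0F , 0F)` the vertex `(1F , 0F)` misses only its partner `(1F , 1F)`. So `k` is 2, and
  -- all vertices in pairs other than 0 and 1 are among two given ones.
  friendship-neighbours : 2 ≤ k → Realizable k G → k ≡ 2 × ∃₂ λ a b → ∀ i c → i ≢ 0F → i ≢ 1F → inj₂ (i , c) ≡ a ⊎ inj₂ (i , c) ≡ b
  friendship-neighbours 2≤k R =
    let k≡2 , a , b , _ , _ , cover = unique-nonneighbour (realizable-neighbourhood {G = G} R (inj₂ (0F , 0F))) 2≤k
          {inj₂ (1F , 0F)} {inj₂ (1F , 1F)} (λ ()) (λ ()) (λ ()) (λ 1≢1 → 1≢1 refl) unique
    in k≡2 , a , b , λ i c i≢0 i≢1 → cover {inj₂ (i , c)} (≢-sym i≢0) (λ { refl → i≢1 refl }) (λ { refl → i≢1 refl })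
    where
    unique : ∀ {v} → Adj G (inj₂ (0F , 0F)) v → v ≢ inj₂ (1F , 0F) → ¬ Adj G (inj₂ (1F , 0F)) v → v ≡ inj₂ (1F , 1F)
    unique {inj₂ (i , c)} _ v≢ ¬1≢i with refl ← decidable-stable (1F ≟ᶠ i) ¬1≢i | c
    ... | 0F = contradiction refl v≢
    ... | 1F = refl

-- `CocktailParty 2` is a 4-cycle and has no triangles.
friendship-2-unrealizable : 2 ≤ k → ¬ Realizable k (Complete 1 ⊔ᴳ CocktailParty 2)
friendship-2-unrealizable = edge-not-in-triangle (Complete 1 ⊔ᴳ CocktailParty 2) {inj₂ (0F , 0F)} {inj₂ (1F , 0F)} (λ ()) λ
  { (inj₂ (0F , _) , 0≢0 , _) → 0≢0 refl
  ; (inj₂ (1F , _) , _ , 1≢1) → 1≢1 refl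
  }

friendship-4-unrealizable : ∀ p → 2 ≤ k → ¬ Realizable k (Complete 1 ⊔ᴳ CocktailParty (4 + p))
friendship-4-unrealizable p 2≤k R with _ , _ , _ , cover ← friendship-neighbours (suc p) 2≤k R =
  -- The pairs 2 and 3 contain four vertices; three of them already exceed the two places allowed.
  no-three-in-two {a = inj₂ (2F , 0F)} {inj₂ (2F , 1F)} {inj₂ (3F , 0F)} (λ ()) (λ ()) (λ ())
    (cover 2F 0F (λ ()) (λ ())) (cover 2F 1F (λ ()) (λ ())) (cover 3F 0F (λ ()) (λ ()))

-- From realizability to the sets of admissible k

≡1⊎≥2 : 1 ≤ k → 1 ≡ k ⊎ 2 ≤ k
≡1⊎≥2 {suc zero}    _ = inj₁ refl
≡1⊎≥2 {suc (suc k)} _ = inj₂ (s≤s (s≤s z≤n))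

𝒦≐all : {G : Graph V} → (∀ {k} → 1 ≤ k → Realizable k G) → 𝒦ᵀˢ G ≐ (1 ≤_)
𝒦≐all realize = proj₁ , λ 1≤k → 1≤k , realize 1≤k

𝒦≐1 : {G : Graph V} → Fin N ↔ V → (∀ {k} → 2 ≤ k → ¬ Realizable k G) → 𝒦ᵀˢ G ≐ ｛ 1 ｝
𝒦≐1 {G = G} f unrealizable
  = (λ (1≤k , R) → [ id , (λ 2≤k → contradiction R (unrealizable 2≤k)) ]′ (≡1⊎≥2 1≤k))
  , λ { refl → s≤s z≤n , realize-1 f G }

-- This covers `l ≡ 1` too: the last hypothesis then excludes every `k` from 2 on, and both
-- singletons agree.
𝒦≐1,l : {G : Graph V} {l : ℕ} → Fin N ↔ V → 1 ≤ l → Realizable l G → (∀ {k} → 2 ≤ k → Realizable k G → l ≡ k) → 𝒦ᵀˢ G ≐ ｛ 1 ｝ ∪ ｛ l ｝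
𝒦≐1,l {G = G} f 1≤l realize only
  = (λ (1≤k , R) → map₂ (λ 2≤k → only 2≤k R) (≡1⊎≥2 1≤k))
  , λ { (inj₁ refl) → s≤s z≤n , realize-1 f G ; (inj₂ refl) → 1≤l , realize }

friendship-vertices : ∀ p → Fin (1 + p * 2) ↔ (Unit ⊎ Fin p × Fin 2)
friendship-vertices p = (1↔⊤ ⊎-↔ *↔×) ↔-∘ +↔⊎

realizable-K̄⇒⊔ : ∀ m n → Realizable k (complement (CompleteBipartite m n)) → Realizable k (Complete m ⊔ᴳ Complete n)
realizable-K̄⇒⊔ m n = realizable-≅ {G = complement (CompleteBipartite m n)} {Complete m ⊔ᴳ Complete n}
  (≅-sym {G = Complete m ⊔ᴳ Complete n} {complement (CompleteBipartite m n)} (complement-K-≅ m n))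

realizable-⊔⇒K̄ : ∀ m n → 1 ≤ k → Realizable k (Complete m) → Realizable k (Complete n) → Realizable k (complement (CompleteBipartite m n))
realizable-⊔⇒K̄ m n 1≤k R S = realizable-≅ {G = Complete m ⊔ᴳ Complete n} {complement (CompleteBipartite m n)} (complement-K-≅ m n)
  (realize-⊔ {G = Complete m} {Complete n} 1≤k R S)

realizable-B̄⇒⊔ : ∀ p → Realizable k (complement (Book p)) → Realizable k (Edgeless 2 ⊔ᴳ Complete p)
realizable-B̄⇒⊔ p = realizable-≅ {G = complement (Book p)} {Edgeless 2 ⊔ᴳ Complete p}
  (≅-sym {G = Edgeless 2 ⊔ᴳ Complete p} {complement (Book p)} (complement-B-≅ p))

realizable-⊔⇒B̄ : ∀ p → 1 ≤ k → Realizable k (Complete p) → Realizable k (complement (Book p))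
realizable-⊔⇒B̄ p 1≤k R = realizable-≅ {G = Edgeless 2 ⊔ᴳ Complete p} {complement (Book p)} (complement-B-≅ p)
  (realize-⊔ {G = Edgeless 2} {Complete p} 1≤k (realize-Edgeless 1≤k 2) R)

realizable-F̄⇒⊔ : ∀ p → Realizable k (complement (Friendship p)) → Realizable k (Complete 1 ⊔ᴳ CocktailParty p)
realizable-F̄⇒⊔ p = realizable-≅ {G = complement (Friendship p)} {Complete 1 ⊔ᴳ CocktailParty p}
  (≅-sym {G = Complete 1 ⊔ᴳ CocktailParty p} {complement (Friendship p)} (complement-F-≅ p))

realizable-⊔⇒F̄ : ∀ p → 1 ≤ k → Realizable k (CocktailParty p) → Realizable k (complement (Friendship p))
realizable-⊔⇒F̄ {k} p 1≤k R = realizable-≅ {G = Complete 1 ⊔ᴳ CocktailParty p} {complement (Friendship p)} (complement-F-≅ p)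
  (realize-⊔ {G = Complete 1} {CocktailParty p} 1≤k (realize-K₁ k) R)

theorem3p7 : (∀ n → 2 ≤ n → 𝒦ᵀˢ (complement (Complete n)) ≐ (1 ≤_))
    × (𝒦ᵀˢ (complement (CompleteBipartite 1 1)) ≐ (1 ≤_)
    × (∀ n → 2 ≤ n → 𝒦ᵀˢ (complement (CompleteBipartite 1 n)) ≐ ｛ 1 ｝ ∪ ｛ n ∸ 1 ｝))
    × (∀ m n → 2 ≤ m → m ≤ n →
    (m ≡ n → 𝒦ᵀˢ (complement (CompleteBipartite m n)) ≐ ｛ 1 ｝ ∪ ｛ n ∸ 1 ｝)
    × (m < n → 𝒦ᵀˢ (complement (CompleteBipartite m n)) ≐ ｛ 1 ｝))
    × (𝒦ᵀˢ (complement (Book 1)) ≐ (1 ≤_)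
    × (∀ p → 2 ≤ p → 𝒦ᵀˢ (complement (Book p)) ≐ ｛ 1 ｝ ∪ ｛ p ∸ 1 ｝))
    × (∀ n → 3 ≤ n → 𝒦ᵀˢ (complement (Path n)) ≐ ｛ 1 ｝)
    × (∀ n → 4 ≤ n → 𝒦ᵀˢ (complement (Cycle n)) ≐ ｛ 1 ｝)
    × (𝒦ᵀˢ (complement (Friendship 1)) ≐ (1 ≤_)
    × 𝒦ᵀˢ (complement (Friendship 2)) ≐ ｛ 1 ｝
    × 𝒦ᵀˢ (complement (Friendship 3)) ≐ ｛ 1 ｝ ∪ ｛ 2 ｝
    × (∀ p → 4 ≤ p → 𝒦ᵀˢ (complement (Friendship p)) ≐ ｛ 1 ｝))
theorem3p7
  = (λ n _ → 𝒦≐all {G = Edgeless n} λ 1≤k → realize-Edgeless 1≤k n)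
  , ( 𝒦≐all {G = complement (CompleteBipartite 1 1)} (λ {k} 1≤k → realizable-⊔⇒K̄ 1 1 1≤k (realize-K₁ k) (realize-K₁ k))
    -- With the size written as `2 + n`, the value `n ∸ 1` of the statement computes to `suc n`.
    , λ { (suc (suc n)) (s≤s (s≤s _)) → 𝒦≐1,l {G = complement (CompleteBipartite 1 (2 + n))} +↔⊎ (s≤s z≤n)
            (realizable-⊔⇒K̄ 1 (2 + n) (s≤s z≤n) (realize-K₁ (suc n)) (realize-K₁₊ₖ (suc n)))
            λ 2≤k R → complete-component-right (Complete 1) (s≤s z≤n) 2≤k (realizable-K̄⇒⊔ 1 (2 + n) R) })
  , (λ { (suc (suc m)) (suc (suc n)) (s≤s (s≤s _)) (s≤s (s≤s _))
         → (λ { refl → 𝒦≐1,l {G = complement (CompleteBipartite (2 + n) (2 + n))} +↔⊎ (s≤s z≤n)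
                  (realizable-⊔⇒K̄ (2 + n) (2 + n) (s≤s z≤n) (realize-K₁₊ₖ (suc n)) (realize-K₁₊ₖ (suc n)))
                  λ 2≤k R → complete-component-right (Complete (2 + n)) (s≤s z≤n) 2≤k (realizable-K̄⇒⊔ (2 + n) (2 + n) R) })
         -- The two components would force `k` to be both `1 + m` and `1 + n`.
         , λ m<n → 𝒦≐1 {G = complement (CompleteBipartite (2 + m) (2 + n))} +↔⊎ λ 2≤k R →
             <⇒≢ m<n (cong suc (trans (complete-component-left (Complete (2 + n)) (s≤s z≤n) 2≤k (realizable-K̄⇒⊔ (2 + m) (2 + n) R))
               (sym (complete-component-right (Complete (2 + m)) (s≤s z≤n) 2≤k (realizable-K̄⇒⊔ (2 + m) (2 + n) R))))) })
  , ( 𝒦≐all {G = complement (Book 1)} (λ {k} 1≤k → realizable-⊔⇒B̄ 1 1≤k (realize-K₁ k))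
    , λ { (suc (suc p)) (s≤s (s≤s _)) → 𝒦≐1,l {G = complement (Book (2 + p))} +↔⊎ (s≤s z≤n)
            (realizable-⊔⇒B̄ (2 + p) (s≤s z≤n) (realize-K₁₊ₖ (suc p)))
            λ 2≤k R → complete-component-right (Edgeless 2) (s≤s z≤n) 2≤k (realizable-B̄⇒⊔ (2 + p) R) })
  , (λ n 3≤n → 𝒦≐1 {G = complement (Path n)} (↔-id _) (path-unrealizable 3≤n))
  , (λ n 4≤n → 𝒦≐1 {G = complement (Cycle n)} (↔-id _) (cycle-unrealizable 4≤n))
  , 𝒦≐all {G = complement (Friendship 1)} (λ 1≤k → realizable-⊔⇒F̄ 1 1≤k
      (realizable-≅ {G = Edgeless 2} {CocktailParty 1} CocktailParty-1-≅ (realize-Edgeless 1≤k 2)))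
  , 𝒦≐1 {G = complement (Friendship 2)} (friendship-vertices 2) (λ 2≤k R → friendship-2-unrealizable 2≤k (realizable-F̄⇒⊔ 2 R))
  , 𝒦≐1,l {G = complement (Friendship 3)} (friendship-vertices 3) (s≤s z≤n) (realizable-⊔⇒F̄ 3 (s≤s z≤n) realize-octahedron)
      (λ 2≤k R → sym (proj₁ (friendship-neighbours 0 2≤k (realizable-F̄⇒⊔ 3 R))))
  , λ { (suc (suc (suc (suc p)))) (s≤s (s≤s (s≤s (s≤s _)))) → 𝒦≐1 {G = complement (Friendship (4 + p))} (friendship-vertices (4 + p))
          λ 2≤k R → friendship-4-unrealizable p 2≤k (realizable-F̄⇒⊔ (4 + p) R) }
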